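{- For every $\alpha \in (1/3, 1/2)$ there exists $\beta>0$ such that the following holds for all sufficiently large $n$: every $n$-vertex graph $G$ with at least $\lfloor n^2/4\rfloor+1$ edges and $b(G)<\alpha n/2$ has at least $\beta n^3$ triangles.
   Context: Graphs are finite and simple. A book of size $b$ in a graph is an edge that lies in $b$ triangles; $b(G)$ denotes the maximum size of a book in $G$, i.e. the maximum, over all edges $e$ of $G$, of the number of triangles of $G$ containing $e$. -}

module Defs where

open import Data.Fin using (Fin; _<_; _<?_)
open import Data.Fin.Properties using (_≟_)
open import Data.Integer using (+_)
open import Data.List using (List; []; _∷_; length; filter; map; allFin; cartesianProduct)
open import Data.List.Extrema.Nat using (max)
open import Data.List.Membership.DecPropositional using () renaming (_∈?_ to ∈?-of)
open import Data.List.Membership.Propositional using (_∈_)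
open import Data.Nat using (ℕ)
open import Data.Product using (_×_; _,_; proj₁; proj₂; ∃; ∃-syntax)
open import Data.Product.Properties using (≡-dec)
open import Data.Rational as ℚ using (ℚ; 0ℚ; 1ℚ; 1/_)
open import Data.Rational.Properties as ℚₚ using (module ≤-Reasoning)
open import Data.Sum using (_⊎_; inj₁; inj₂; [_,_]′)
open import Function using (_⇔_; mk⇔; Equivalence)
open import Level using (0ℓ)
open import Relation.Binary using (Rel; Decidable; Symmetric; Irreflexive; tri<; tri≈; tri>)
open import Relation.Binary.PropositionalEquality using (_≡_; refl; sym; trans; cong; subst)
open import Relation.Nullary using (¬_; Dec; _×-dec_)
open import Relation.Nullary.Negation using (contradiction)

record Graph (n : ℕ) : Set₁ where
  field
    Adj    : Rel (Fin n) 0ℓ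
    adj?   : Decidable Adj
    symm   : Symmetric Adj
    irrefl : Irreflexive _≡_ Adj

-- An edge is represented by its endpoints in increasing order, and a
-- triangle by its three vertices in increasing order, so that each edge and
-- each triangle is listed exactly once.

Edge : ℕ → Set
Edge n = Fin n × Fin n

Triangle : ℕ → Set
Triangle n = Fin n × Fin n × Fin n

infix 4 _∈?_

_∈?_ : ∀ {n} → Decidable (_∈_ {A = Edge n})
_∈?_ = ∈?-of (≡-dec _≟_ _≟_)

triangleEdges : ∀ {n} → Triangle n → List (Edge n)
triangleEdges (i , j , k) = (i , j) ∷ (i , k) ∷ (j , k) ∷ []

module _ {n : ℕ} (G : Graph n) where
  open Graph G

  IsEdge : Edge n → Set
  IsEdge (i , j) = i < j × Adj i j

  isEdge? : ∀ e → Dec (IsEdge e)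
  isEdge? (i , j) = (i <? j) ×-dec adj? i j

  IsTriangle : Triangle n → Set
  IsTriangle (i , j , k) = (i < j × j < k) × (Adj i j × Adj i k × Adj j k)

  isTriangle? : ∀ t → Dec (IsTriangle t)
  isTriangle? (i , j , k) =
    ((i <? j) ×-dec (j <? k)) ×-dec (adj? i j ×-dec adj? i k ×-dec adj? j k)

  edges : List (Edge n)
  edges = filter isEdge? (cartesianProduct (allFin n) (allFin n))

  triangles : List (Triangle n)
  triangles = filter isTriangle?
    (cartesianProduct (allFin n) (cartesianProduct (allFin n) (allFin n)))

  #edges : ℕ
  #edges = length edges

  #triangles : ℕ
  #triangles = length triangles

  bookSize : Edge n → ℕ
  bookSize e = length (filter (λ t → e ∈? triangleEdges t) triangles)

  -- This is 0 when there are no edges.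
  b : ℕ
  b = max 0 (map bookSize edges)

-- Located Dedekind cuts: Lower q means q < x, and Upper q means x < q.

record ℝ : Set₁ where
  field
    Lower     : ℚ → Set
    Upper     : ℚ → Set
    lowerInh  : ∃ Lower
    upperInh  : ∃ Upper
    lowerOpen : ∀ {p} → Lower p ⇔ (∃[ q ] p ℚ.< q × Lower q)
    upperOpen : ∀ {q} → Upper q ⇔ (∃[ p ] p ℚ.< q × Upper p)
    disjoint  : ∀ {q} → ¬ (Lower q × Upper q)
    located   : ∀ {p q} → p ℚ.< q → Lower p ⊎ Upper q

  lower<upper : ∀ {p q} → Lower p → Upper q → p ℚ.< q
  lower<upper {p} {q} l u with ℚₚ.<-cmp p q
  ... | tri< p<q _ _  = p<q
  ... | tri≈ _ refl _ = contradiction (l , u) disjoint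
  ... | tri> _ _ q<p  =
    contradiction (l , Equivalence.from upperOpen (q , q<p , u)) disjoint

open ℝ

infix 4 _<ᴿ_ _≤ᴿ_

_<ᴿ_ : ℝ → ℝ → Set
x <ᴿ y = ∃[ q ] Upper x q × Lower y q

_≤ᴿ_ : ℝ → ℝ → Set
x ≤ᴿ y = ∀ q → Lower x q → Lower y q

private
  below : ∀ p → ∃[ q ] q ℚ.< p
  below p = p ℚ.- 1ℚ ,
    subst (p ℚ.- 1ℚ ℚ.<_) (ℚₚ.+-identityʳ p) (ℚₚ.+-monoʳ-< p (ℚₚ.negative⁻¹ (ℚ.- 1ℚ)))

  above : ∀ p → ∃[ q ] p ℚ.< q
  above p = p ℚ.+ 1ℚ ,
    subst (ℚ._< p ℚ.+ 1ℚ) (ℚₚ.+-identityʳ p) (ℚₚ.+-monoʳ-< p (ℚₚ.positive⁻¹ 1ℚ))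

  <-located : ∀ r {p q} → p ℚ.< q → p ℚ.< r ⊎ r ℚ.< q
  <-located r {p} p<q with ℚₚ.<-cmp p r
  ... | tri< p<r _ _  = inj₁ p<r
  ... | tri≈ _ refl _ = inj₂ p<q
  ... | tri> _ _ r<p  = inj₂ (ℚₚ.<-trans r<p p<q)

fromℚ : ℚ → ℝ
fromℚ r = record
  { Lower     = ℚ._< r
  ; Upper     = r ℚ.<_
  ; lowerInh  = below r
  ; upperInh  = above r
  ; lowerOpen = mk⇔ ℚₚ.<-dense (λ (_ , p<q , q<r) → ℚₚ.<-trans p<q q<r)
  ; upperOpen = mk⇔ (λ r<q → let m , r<m , m<q = ℚₚ.<-dense r<q in m , m<q , r<m)
                    (λ (_ , p<q , r<p) → ℚₚ.<-trans r<p p<q)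
  ; disjoint  = λ (q<r , r<q) → ℚₚ.<-asym q<r r<q
  ; located   = <-located r
  }

fromℕ : ℕ → ℝ
fromℕ n = fromℚ (+ n ℚ./ 1)

0ℝ : ℝ
0ℝ = fromℚ 0ℚ

-- Interval multiplication: if c < x < d then r x lies between r c and r d,
-- in an order that depends on the sign of r.

private
  module Scale (r : ℚ) (x : ℝ) where
    L U : ℚ → Set
    L q = ∃[ c ] ∃[ d ] (Lower x c × Upper x d × q ℚ.< (r ℚ.* c) ℚ.⊓ (r ℚ.* d))
    U q = ∃[ c ] ∃[ d ] (Lower x c × Upper x d × (r ℚ.* c) ℚ.⊔ (r ℚ.* d) ℚ.< q)

    c₀ d₀ : ℚ
    c₀ = proj₁ (lowerInh x)
    d₀ = proj₁ (upperInh x)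

    Lc₀ : Lower x c₀
    Lc₀ = proj₂ (lowerInh x)

    Ud₀ : Upper x d₀
    Ud₀ = proj₂ (upperInh x)

    mkL : ∀ {c d q} → Lower x c → Upper x d → q ℚ.< r ℚ.* c → q ℚ.< r ℚ.* d → L q
    mkL {c} {d} l u q<rc q<rd with ℚₚ.≤-total (r ℚ.* c) (r ℚ.* d)
    ... | inj₁ le = c , d , l , u , subst (_ ℚ.<_) (sym (ℚₚ.p≤q⇒p⊓q≡p le)) q<rc
    ... | inj₂ ge = c , d , l , u , subst (_ ℚ.<_) (sym (ℚₚ.p≥q⇒p⊓q≡q ge)) q<rd

    mkU : ∀ {c d q} → Lower x c → Upper x d → r ℚ.* c ℚ.< q → r ℚ.* d ℚ.< q → U q
    mkU {c} {d} l u rc<q rd<q with ℚₚ.≤-total (r ℚ.* c) (r ℚ.* d)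
    ... | inj₁ le = c , d , l , u , subst (ℚ._< _) (sym (ℚₚ.p≤q⇒p⊔q≡q le)) rd<q
    ... | inj₂ ge = c , d , l , u , subst (ℚ._< _) (sym (ℚₚ.p≥q⇒p⊔q≡p ge)) rc<q

    L-open : ∀ {p} → L p ⇔ (∃[ q ] p ℚ.< q × L q)
    L-open = mk⇔
      (λ (c , d , l , u , p<) → let m , p<m , m< = ℚₚ.<-dense p< in
                                m , p<m , c , d , l , u , m<)
      (λ (_ , p<q , c , d , l , u , q<) → c , d , l , u , ℚₚ.<-trans p<q q<)

    U-open : ∀ {q} → U q ⇔ (∃[ p ] p ℚ.< q × U p)
    U-open = mk⇔
      (λ (c , d , l , u , <q) → let m , <m , m<q = ℚₚ.<-dense <q in
                                m , m<q , c , d , l , u , <m)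
      (λ (_ , p<q , c , d , l , u , <p) → c , d , l , u , ℚₚ.<-trans <p p<q)

    LU-disjoint : ∀ {q} → ¬ (L q × U q)
    LU-disjoint {q} ((c , d , Lc , Ud , q<) , (c′ , d′ , Lc′ , Ud′ , <q))
      with ℚₚ.≤-total 0ℚ r
    ... | inj₁ 0≤r = ℚₚ.<-irrefl refl (begin-strict
      q                            <⟨ q< ⟩
      (r ℚ.* c) ℚ.⊓ (r ℚ.* d)      ≤⟨ ℚₚ.p⊓q≤p _ _ ⟩
      r ℚ.* c                      ≤⟨ ℚₚ.*-monoˡ-≤-nonNeg r {{ℚ.nonNegative 0≤r}}
                                        (ℚₚ.<⇒≤ (lower<upper x Lc Ud′)) ⟩
      r ℚ.* d′                     ≤⟨ ℚₚ.p≤q⊔p (r ℚ.* c′) _ ⟩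
      (r ℚ.* c′) ℚ.⊔ (r ℚ.* d′)    <⟨ <q ⟩
      q                            ∎)
      where open ≤-Reasoning
    ... | inj₂ r≤0 = ℚₚ.<-irrefl refl (begin-strict
      q                            <⟨ q< ⟩
      (r ℚ.* c) ℚ.⊓ (r ℚ.* d)      ≤⟨ ℚₚ.p⊓q≤q (r ℚ.* c) _ ⟩
      r ℚ.* d                      ≤⟨ ℚₚ.*-monoˡ-≤-nonPos r {{ℚ.nonPositive r≤0}}
                                        (ℚₚ.<⇒≤ (lower<upper x Lc′ Ud)) ⟩
      r ℚ.* c′                     ≤⟨ ℚₚ.p≤p⊔q _ _ ⟩
      (r ℚ.* c′) ℚ.⊔ (r ℚ.* d′)    <⟨ <q ⟩
      q                            ∎)
      where open ≤-Reasoning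

    cancel : .{{_ : ℚ.NonZero r}} → ∀ m → r ℚ.* ((1/ r) ℚ.* m) ≡ m
    cancel m = trans (sym (ℚₚ.*-assoc r (1/ r) m))
                     (trans (cong (ℚ._* m) (ℚₚ.*-inverseʳ r)) (ℚₚ.*-identityˡ m))

    located-pos : .{{ℚ.Positive r}} → ∀ {p q} → p ℚ.< q → L p ⊎ U q
    located-pos {p} {q} p<q =
      let instance _ = ℚₚ.pos⇒nonZero r
                   _ = ℚₚ.1/pos⇒pos r
          m  , p<m , m<q  = ℚₚ.<-dense p<q
          m′ , m<m′ , m′<q = ℚₚ.<-dense m<q
          p<rc = subst (p ℚ.<_) (sym (cancel m)) p<m
          rd<q = subst (ℚ._< q) (sym (cancel m′)) m′<q
      in [ (λ l → inj₁ (mkL l Ud₀ p<rc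
             (ℚₚ.<-trans p<rc (ℚₚ.*-monoʳ-<-pos r (lower<upper x l Ud₀)))))
         , (λ u → inj₂ (mkU Lc₀ u
             (ℚₚ.<-trans (ℚₚ.*-monoʳ-<-pos r (lower<upper x Lc₀ u)) rd<q) rd<q))
         ]′ (located x (ℚₚ.*-monoʳ-<-pos (1/ r) m<m′))

    located-neg : .{{ℚ.Negative r}} → ∀ {p q} → p ℚ.< q → L p ⊎ U q
    located-neg {p} {q} p<q =
      let instance _ = ℚₚ.neg⇒nonZero r
                   _ = ℚₚ.1/neg⇒neg r
          m  , p<m , m<q  = ℚₚ.<-dense p<q
          m′ , m<m′ , m′<q = ℚₚ.<-dense m<q
          p<rd = subst (p ℚ.<_) (sym (cancel m)) p<m
          rc<q = subst (ℚ._< q) (sym (cancel m′)) m′<q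
      in [ (λ l → inj₂ (mkU l Ud₀ rc<q
             (ℚₚ.<-trans (ℚₚ.*-monoʳ-<-neg r (lower<upper x l Ud₀)) rc<q)))
         , (λ u → inj₁ (mkL Lc₀ u
             (ℚₚ.<-trans p<rd (ℚₚ.*-monoʳ-<-neg r (lower<upper x Lc₀ u))) p<rd))
         ]′ (located x (ℚₚ.*-monoʳ-<-neg (1/ r) m<m′))

    located-zero : r ≡ 0ℚ → ∀ {p q} → p ℚ.< q → L p ⊎ U q
    located-zero refl p<q with <-located 0ℚ p<q
    ... | inj₁ p<0 = inj₁ (mkL Lc₀ Ud₀ (subst (_ ℚ.<_) (sym (ℚₚ.*-zeroˡ c₀)) p<0)
                                       (subst (_ ℚ.<_) (sym (ℚₚ.*-zeroˡ d₀)) p<0))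
    ... | inj₂ 0<q = inj₂ (mkU Lc₀ Ud₀ (subst (ℚ._< _) (sym (ℚₚ.*-zeroˡ c₀)) 0<q)
                                       (subst (ℚ._< _) (sym (ℚₚ.*-zeroˡ d₀)) 0<q))

    LU-located : ∀ {p q} → p ℚ.< q → L p ⊎ U q
    LU-located with ℚₚ.<-cmp r 0ℚ
    ... | tri< r<0 _ _ = located-neg {{ℚ.negative r<0}}
    ... | tri≈ _ r≡0 _ = located-zero r≡0
    ... | tri> _ _ 0<r = located-pos {{ℚ.positive 0<r}}

infixr 7 _·_

_·_ : ℚ → ℝ → ℝ
r · x = record
  { Lower     = L
  ; Upper     = U
  ; lowerInh  = let q , q< = below _ in q , c₀ , d₀ , Lc₀ , Ud₀ , q<
  ; upperInh  = let q , <q = above _ in q , c₀ , d₀ , Lc₀ , Ud₀ , <q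
  ; lowerOpen = L-open
  ; upperOpen = U-open
  ; disjoint  = LU-disjoint
  ; located   = LU-located
  }
  where open Scale r x

{-# OPTIONS --safe #-}
-- Assume there are o(n³) triangles. Goodman's counting inequality then forces
-- ∑ (2 d(v) - n)² = o(n³), so all but o(n) vertices have degree at least
-- (1 - 1/m) n/2. Deleting the few exceptions leaves more than a quarter of the
-- square of the remaining order in edges, so by Mantel's theorem there is a
-- triangle xyz all of whose vertices have high degree. By averaging, some vertex
-- u has degree close to n/2 and few triangles; its neighbourhood A and the
-- complement B then span almost all pairs of A × B. A high-degree vertex x with
-- many neighbours in both parts lies on a book of size nearly n/4: almost every
-- pair of neighbours of x across the parts is an edge, and one part contains
-- half of the neighbours. Otherwise x, y and z each have almost all their
-- neighbours in a single part, two of them in the same one, and the edge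
-- between these two is in nearly n/2 triangles.
module Submission where

open import Defs
open import Data.Empty using (⊥; ⊥-elim)
open import Data.Fin as Fin using (Fin; zero; suc)
import Data.Fin.Properties as Fin
open import Data.Integer using (+_)
open import Data.Integer.Tactic.RingSolver using (solve; solve-∀)
open import Data.List using (List; []; _∷_; _++_; length; filter; map; tabulate; allFin; cartesianProduct)
open import Data.List.Extrema.Nat using (xs≤max)
open import Data.List.Membership.Propositional using (_∈_)
open import Data.List.Membership.Propositional.Properties
  using (∈-∃++; ∈-++⁻; ∈-++⁺ˡ; ∈-++⁺ʳ; ∈-filter⁺; ∈-filter⁻; ∈-map⁺; ∈-cartesianProduct⁺; ∈-allFin)
open import Data.List.Properties using (length-++; length-map; filter-++)
open import Data.List.Relation.Unary.All as All using ()
open import Data.List.Relation.Unary.AllPairs using (_∷_)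
open import Data.List.Relation.Unary.Any using (here; there)
open import Data.List.Relation.Unary.Unique.Propositional using (Unique)
import Data.List.Relation.Unary.Unique.Propositional.Properties as Unique
open import Data.Nat as ℕ using (ℕ)
import Data.Nat.DivMod as ℕ
import Data.Nat.Properties as ℕ
open import Data.Nat.Tactic.RingSolver using () renaming (solve-∀ to ℕ-solve-∀)
open import Data.Product using (_×_; _,_; ∃-syntax; proj₂)
open import Data.Rational using (_/_)
open import Data.Sum using (_⊎_; inj₁; inj₂)
open import Relation.Binary using (tri<; tri≈; tri>)
open import Relation.Binary.PropositionalEquality
open import Relation.Nullary using (¬_; Dec; yes; no; contradiction; _×-dec_)
open import Relation.Unary using (Decidable)

module Counting where

  open import Data.Integer hiding (suc; _/_)
  open import Data.Integer.Properties
  open import Algebra.Properties.Semiring.Sum +-*-semiring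
    using (∑-distrib-+; ∑-comm; sum-cong-≗; *-distribˡ-sum; *-distribʳ-sum)
    renaming (sum to ∑)

  -- An inequality i ≤ j is proved by exhibiting j - i as a combination of
  -- nonnegative terms; the ring solver checks the resulting identity.

  infixl 6 _⊕_
  infixl 7 _⊗_

  _⊕_ : ∀ {i j} → 0ℤ ≤ i → 0ℤ ≤ j → 0ℤ ≤ i + j
  _⊕_ = +-mono-≤

  _⊗_ : ∀ {i j} → 0ℤ ≤ i → 0ℤ ≤ j → 0ℤ ≤ i * j
  _⊗_ {+ m} {+ n} (+≤+ _) (+≤+ _) = subst (0ℤ ≤_) (pos-* m n) (+≤+ ℕ.z≤n)

  lit : ∀ n → 0ℤ ≤ + n
  lit n = +≤+ ℕ.z≤n

  gap : ∀ {i j} → i ≤ j → 0ℤ ≤ j - i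
  gap = i≤j⇒0≤j-i

  cert : ∀ {i j c} → 0ℤ ≤ c → c ≡ j - i → i ≤ j
  cert 0≤c c≡ = 0≤i-j⇒j≤i (subst (0ℤ ≤_) c≡ 0≤c)

  ≤-suc : ∀ {i j} → i < j → 1ℤ + i ≤ j
  ≤-suc = i<j⇒suc[i]≤j

  square-nonneg : ∀ i → 0ℤ ≤ i * i
  square-nonneg (+ n)    = lit n ⊗ lit n
  square-nonneg -[1+ n ] = lit _

  -- Finite sums of integers

  ∑-distrib-- : ∀ {n} (f g : Fin n → ℤ) → ∑ (λ i → f i - g i) ≡ ∑ f - ∑ g
  ∑-distrib-- {ℕ.zero}  f g = refl
  ∑-distrib-- {ℕ.suc n} f g
    rewrite ∑-distrib-- (λ i → f (suc i)) (λ i → g (suc i)) =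
    regroup (f zero) (g zero) _ _
    where
    regroup : ∀ p q r s → p - q + (r - s) ≡ p + r - (q + s)
    regroup = solve-∀

  ∑-const : ∀ n c → ∑ {n} (λ _ → c) ≡ + n * c
  ∑-const ℕ.zero    c = refl
  ∑-const (ℕ.suc n) c rewrite ∑-const n c = sym (suc-* (+ n) c)

  ∑-mono : ∀ {n} {f g : Fin n → ℤ} → (∀ i → f i ≤ g i) → ∑ f ≤ ∑ g
  ∑-mono {ℕ.zero}  f≤g = ≤-refl
  ∑-mono {ℕ.suc n} f≤g = +-mono-≤ (f≤g zero) (∑-mono (λ i → f≤g (suc i)))

  ∑-nonneg : ∀ {n} {f : Fin n → ℤ} → (∀ i → 0ℤ ≤ f i) → 0ℤ ≤ ∑ f
  ∑-nonneg {ℕ.zero}  0≤f = ≤-refl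
  ∑-nonneg {ℕ.suc n} 0≤f = 0≤f zero ⊕ ∑-nonneg (λ i → 0≤f (suc i))

  -- The averaging principle: it later picks the central vertex and the vertices of the high-degree
  -- triangle. The order on ℤ is decidable, so the index can be searched for from the front.
  ∑-<-witness : ∀ {n} (f g : Fin n → ℤ) → ∑ f < ∑ g → ∃[ i ] f i < g i
  ∑-<-witness {ℕ.zero}  f g ∑f<∑g = contradiction ∑f<∑g (<-irrefl refl)
  ∑-<-witness {ℕ.suc n} f g ∑f<∑g with f zero <? g zero
  ... | yes f₀<g₀ = zero , f₀<g₀
  ... | no  f₀≮g₀ with ∑ (λ i → f (suc i)) <? ∑ (λ i → g (suc i))
  ...   | yes tail< = let i , fi<gi = ∑-<-witness _ _ tail< in suc i , fi<gi
  ...   | no  tail≮ =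
    contradiction ∑f<∑g (≤⇒≯ (+-mono-≤ (≮⇒≥ f₀≮g₀) (≮⇒≥ tail≮)))

  ∑-positive-witness : ∀ {n} (f : Fin n → ℤ) → 0ℤ < ∑ f → ∃[ i ] 0ℤ < f i
  ∑-positive-witness {n} f 0<∑f =
    ∑-<-witness (λ _ → 0ℤ) f
      (subst (_< ∑ f) (sym (trans (∑-const n 0ℤ) (*-zeroʳ (+ n)))) 0<∑f)

  -- Goodman's inequality for weighted graphs

  module Weighted {n : ℕ} (a : Fin n → Fin n → ℤ) (w : Fin n → ℤ) where

    order : ℤ
    order = ∑ w

    deg : Fin n → ℤ
    deg i = ∑ λ j → w j * a i j

    codeg : Fin n → Fin n → ℤ
    codeg i j = ∑ λ k → w k * (a i k * a j k)

    -- Both `degSum` and `triSum` run over ordered tuples: for a graph with unit weights they are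
    -- twice the number of edges and six times the number of triangles.
    degSum : ℤ
    degSum = ∑ λ i → w i * deg i

    triSum : ℤ
    triSum = ∑ λ i → ∑ λ j → w i * w j * a i j * codeg i j

    module _ (symm : ∀ i j → a i j ≡ a j i)
             (0≤a : ∀ i j → 0ℤ ≤ a i j) (a≤1 : ∀ i j → a i j ≤ 1ℤ)
             (0≤w : ∀ i → 0ℤ ≤ w i) where

      private
        degSquares : ℤ
        degSquares = ∑ λ i → w i * (deg i * deg i)

        W : Fin n → Fin n → ℤ
        W i j = w i * w j * a i j

      -- By inclusion-exclusion, the expression is the sum of w k (1 - a i k) (1 - a j k), the total
      -- weight of the common non-neighbours of i and j.
      nonneighbours : ∀ i j → 0ℤ ≤ order - deg i - deg j + codeg i j
      nonneighbours i j = subst (0ℤ ≤_) expand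
        (∑-nonneg λ k → 0≤w k ⊗ gap (a≤1 i k) ⊗ gap (a≤1 j k))
        where
        open ≡-Reasoning
        pointwise : ∀ w x y → w * (1ℤ - x) * (1ℤ - y) ≡ w - w * x - w * y + w * (x * y)
        pointwise = solve-∀
        expand : ∑ (λ k → w k * (1ℤ - a i k) * (1ℤ - a j k)) ≡ order - deg i - deg j + codeg i j
        expand = begin
          ∑ (λ k → w k * (1ℤ - a i k) * (1ℤ - a j k))
            ≡⟨ sum-cong-≗ (λ k → pointwise (w k) (a i k) (a j k)) ⟩
          ∑ (λ k → w k - w k * a i k - w k * a j k + w k * (a i k * a j k))
            ≡⟨ ∑-distrib-+ (λ k → w k - w k * a i k - w k * a j k) _ ⟩
          ∑ (λ k → w k - w k * a i k - w k * a j k) + codeg i j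
            ≡⟨ cong (_+ codeg i j) (∑-distrib-- (λ k → w k - w k * a i k) _) ⟩
          ∑ (λ k → w k - w k * a i k) - deg j + codeg i j
            ≡⟨ cong (λ x → x - deg j + codeg i j) (∑-distrib-- w _) ⟩
          order - deg i - deg j + codeg i j ∎

      private
        row : ∀ i c → ∑ (λ j → W i j * c) ≡ w i * deg i * c
        row i c = begin
          ∑ (λ j → w i * w j * a i j * c)  ≡⟨ *-distribʳ-sum c (W i) ⟨
          ∑ (λ j → w i * w j * a i j) * c
            ≡⟨ cong (_* c) (sum-cong-≗ λ j → *-assoc (w i) (w j) (a i j)) ⟩
          ∑ (λ j → w i * (w j * a i j)) * c
            ≡⟨ cong (_* c) (*-distribˡ-sum (w i) (λ j → w j * a i j)) ⟨
          w i * deg i * c                  ∎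
          where open ≡-Reasoning

        W-sym : ∀ i j → W i j ≡ W j i
        W-sym i j = cong₂ _*_ (*-comm (w i) (w j)) (symm i j)

        ∑-order : ∑ (λ i → ∑ λ j → W i j * order) ≡ degSum * order
        ∑-order = trans (sum-cong-≗ λ i → row i order) (sym (*-distribʳ-sum order λ i → w i * deg i))

        ∑-degˡ : ∑ (λ i → ∑ λ j → W i j * deg i) ≡ degSquares
        ∑-degˡ = sum-cong-≗ λ i → trans (row i (deg i)) (*-assoc (w i) (deg i) (deg i))

        ∑-degʳ : ∑ (λ i → ∑ λ j → W i j * deg j) ≡ degSquares
        ∑-degʳ = begin
          ∑ (λ i → ∑ λ j → W i j * deg j)  ≡⟨ ∑-comm (λ i j → W i j * deg j) ⟩
          ∑ (λ j → ∑ λ i → W i j * deg j)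
            ≡⟨ (sum-cong-≗ λ j → sum-cong-≗ λ i → cong (_* deg j) (W-sym i j)) ⟩
          ∑ (λ j → ∑ λ i → W j i * deg j)  ≡⟨ ∑-degˡ ⟩
          degSquares                       ∎
          where open ≡-Reasoning

        ∑∑-expand : (f g h k : Fin n → Fin n → ℤ) →
          ∑ (λ i → ∑ λ j → f i j - g i j - h i j + k i j) ≡
          ∑ (λ i → ∑ (f i)) - ∑ (λ i → ∑ (g i)) - ∑ (λ i → ∑ (h i)) + ∑ (λ i → ∑ (k i))
        ∑∑-expand f g h k = begin
          ∑ (λ i → ∑ λ j → f i j - g i j - h i j + k i j)
            ≡⟨ (sum-cong-≗ λ i → trans (∑-distrib-+ (λ j → f i j - g i j - h i j) (k i))
                (cong (_+ ∑ (k i)) (trans (∑-distrib-- (λ j → f i j - g i j) (h i))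
                  (cong (_- ∑ (h i)) (∑-distrib-- (f i) (g i)))))) ⟩
          ∑ (λ i → ∑ (f i) - ∑ (g i) - ∑ (h i) + ∑ (k i))
            ≡⟨ trans (∑-distrib-+ (λ i → ∑ (f i) - ∑ (g i) - ∑ (h i)) _)
                (cong (_+ ∑ (λ i → ∑ (k i))) (trans (∑-distrib-- (λ i → ∑ (f i) - ∑ (g i)) _)
                  (cong (_- ∑ (λ i → ∑ (h i))) (∑-distrib-- (λ i → ∑ (f i)) _)))) ⟩
          ∑ (λ i → ∑ (f i)) - ∑ (λ i → ∑ (g i)) - ∑ (λ i → ∑ (h i)) + ∑ (λ i → ∑ (k i)) ∎
          where open ≡-Reasoning

      -- `nonneighbours` is summed over ordered adjacent pairs with weight `W i j`. Each of the two
      -- endpoint degrees contributes one copy of `degSquares`.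
      goodman : degSquares + degSquares ≤ degSum * order + triSum
      goodman = cert
        (∑-nonneg λ i → ∑-nonneg λ j → 0≤w i ⊗ 0≤w j ⊗ 0≤a i j ⊗ nonneighbours i j)
        (begin
          ∑ (λ i → ∑ λ j → W i j * (order - deg i - deg j + codeg i j))
            ≡⟨ (sum-cong-≗ λ i → sum-cong-≗ λ j →
                  distrib (W i j) order (deg i) (deg j) (codeg i j)) ⟩
          ∑ (λ i → ∑ λ j →
               W i j * order - W i j * deg i - W i j * deg j + W i j * codeg i j)
            ≡⟨ ∑∑-expand (λ i j → W i j * order) _ _ _ ⟩
          ∑ (λ i → ∑ λ j → W i j * order) - ∑ (λ i → ∑ λ j → W i j * deg i)
            - ∑ (λ i → ∑ λ j → W i j * deg j) + triSum
            ≡⟨ cong (_+ triSum) (cong₂ _-_ (cong₂ _-_ ∑-order ∑-degˡ) ∑-degʳ) ⟩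
          degSum * order - degSquares - degSquares + triSum
            ≡⟨ regroup (degSum * order) degSquares triSum ⟩
          degSum * order + triSum - (degSquares + degSquares) ∎)
        where
        open ≡-Reasoning
        distrib : ∀ W o p q r → W * (o - p - q + r) ≡ W * o - W * p - W * q + W * r
        distrib = solve-∀
        regroup : ∀ e q t → e - q - q + t ≡ e + t - (q + q)
        regroup = solve-∀

      -- Expanding the square leaves 4 `degSquares`, which twice `goodman` bounds. With unit weights
      -- this controls the degrees of the graph; on the high-degree core, nonnegativity of the
      -- left-hand side yields triangles.
      degVariance :
        ∑ (λ i → w i * ((+ 2 * deg i - order) * (+ 2 * deg i - order))) ≤
        + 2 * triSum + order * (order * order - + 2 * degSum)
      degVariance = subst (_≤ + 2 * triSum + order * (order * order - + 2 * degSum)) (sym expand)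
        (cert (lit 2 ⊗ gap goodman) (combine degSum degSquares triSum order))
        where
        open ≡-Reasoning
        pointwise : ∀ w d o → w * ((+ 2 * d - o) * (+ 2 * d - o)) ≡
                    + 4 * (w * (d * d)) - + 4 * o * (w * d) + o * o * w
        pointwise = solve-∀
        expand : ∑ (λ i → w i * ((+ 2 * deg i - order) * (+ 2 * deg i - order))) ≡
                 + 4 * degSquares - + 4 * order * degSum + order * order * order
        expand = begin
          ∑ (λ i → w i * ((+ 2 * deg i - order) * (+ 2 * deg i - order)))
            ≡⟨ sum-cong-≗ (λ i → pointwise (w i) (deg i) order) ⟩
          ∑ (λ i → + 4 * (w i * (deg i * deg i)) - + 4 * order * (w i * deg i)
                   + order * order * w i)
            ≡⟨ ∑-distrib-+ (λ i → + 4 * (w i * (deg i * deg i)) - + 4 * order * (w i * deg i)) _ ⟩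
          ∑ (λ i → + 4 * (w i * (deg i * deg i)) - + 4 * order * (w i * deg i))
            + ∑ (λ i → order * order * w i)
            ≡⟨ cong₂ _+_
                 (trans (∑-distrib-- (λ i → + 4 * (w i * (deg i * deg i))) _)
                   (cong₂ _-_ (sym (*-distribˡ-sum (+ 4) λ i → w i * (deg i * deg i)))
                              (sym (*-distribˡ-sum (+ 4 * order) λ i → w i * deg i))))
                 (sym (*-distribˡ-sum (order * order) w)) ⟩
          + 4 * degSquares - + 4 * order * degSum + order * order * order ∎
        combine : ∀ e q t o → + 2 * (e * o + t - (q + q)) ≡
                  + 2 * t + o * (o * o - + 2 * e) - (+ 4 * q - + 4 * o * e + o * o * o)
        combine = solve-∀

  -- Arithmetic of the counting argument

  -- The counterpart of `cert` for contradictions: a combination of nonnegative terms collapses to a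
  -- negative constant.
  absurd : ∀ {c p} → 0ℤ ≤ c → c ≡ -[1+ p ] → ⊥
  absurd () refl

  1≤⇒0≤ : ∀ {i} → 1ℤ ≤ i → 0ℤ ≤ i
  1≤⇒0≤ = ≤-trans (lit 1)

  *-pos-factors : ∀ {i j} → 0ℤ ≤ i → 0ℤ ≤ j → 0ℤ < i * j → 0ℤ < i × 0ℤ < j
  *-pos-factors {+ ℕ.zero}  {+ _}         _ _ (+<+ ())
  *-pos-factors {+ ℕ.suc m} {+ ℕ.zero}    _ _ 0<ij =
    contradiction (subst (0ℤ <_) (*-zeroʳ (+ ℕ.suc m)) 0<ij) (<-irrefl refl)
  *-pos-factors {+ ℕ.suc _} {+ ℕ.suc _}   _ _ _ = +<+ ℕ.z<s , +<+ ℕ.z<s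
  *-pos-factors { -[1+ _ ]} ()
  *-pos-factors {+ _} { -[1+ _ ]} _ ()

  square-cancel-≤ : ∀ x y → 0ℤ ≤ y → x * x ≤ y * y → x ≤ y
  square-cancel-≤ x y 0≤y x²≤y² with x ≤? y
  ... | yes x≤y = x≤y
  ... | no  x≰y = ⊥-elim (absurd
    (gap x²≤y² ⊕ square-nonneg (x - (1ℤ + y))
      ⊕ lit 2 ⊗ (lit 1 ⊕ 0≤y) ⊗ gap (≤-suc (≰⇒> x≰y)) ⊕ lit 2 ⊗ 0≤y)
    eq)
    where
    eq : (y * y - x * x) + (x - (1ℤ + y)) * (x - (1ℤ + y))
         + + 2 * (1ℤ + y) * (x - (1ℤ + y)) + + 2 * y ≡ -1ℤ
    eq = solve (x ∷ y ∷ [])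

  -- Below, m (n - 2 d) ≤ n says that the degree d is at least (1 - 1/m) n/2, and s
  -- is the number of vertices violating this.

  low⇒square : ∀ {m n d} → 0ℤ ≤ n → n ≤ m * (n - + 2 * d) →
    n * n ≤ m * m * ((+ 2 * d - n) * (+ 2 * d - n))
  low⇒square {m} {n} {d} 0≤n low =
    cert (gap low ⊗ (gap low ⊕ lit 2 ⊗ 0≤n)) eq
    where
    eq : (m * (n - + 2 * d) - n) * (m * (n - + 2 * d) - n + + 2 * n) ≡
         m * m * ((+ 2 * d - n) * (+ 2 * d - n)) - n * n
    eq = solve (m ∷ n ∷ d ∷ [])

  -- The first bound times 4 m gives 4 m s n² ≤ 8 m³ T < n³, and n² cancels. In the certificate the
  -- strictness of the last step leaves the constant -1.
  few-low : ∀ {m n s T} → 1ℤ ≤ m → s * (n * n) ≤ m * m * (+ 2 * T) →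
    + 8 * (m * m * m) * T < n * n * n → + 4 * m * s ≤ n
  few-low {m} {n} {s} {T} 1≤m h few with + 4 * m * s ≤? n
  ... | yes p = p
  ... | no ¬p = ⊥-elim (absurd
    (lit 4 ⊗ 1≤⇒0≤ 1≤m ⊗ gap h ⊕ gap (≤-suc few)
      ⊕ square-nonneg n ⊗ gap (≤-trans (n≤suc n) (≤-suc (≰⇒> ¬p))))
    eq)
    where
    n≤suc : ∀ i → i ≤ 1ℤ + i
    n≤suc i = i≤suc[i] i
    eq : + 4 * m * (m * m * (+ 2 * T) - s * (n * n))
         + (n * n * n - (1ℤ + + 8 * (m * m * m) * T))
         + n * n * (+ 4 * m * s - n) ≡ -1ℤ
    eq = solve (m ∷ n ∷ s ∷ T ∷ [])

  -- Here `X` and `t` stand for `deviation u` and `triDeg u` at the central vertex u. Since m ≥ 1,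
  -- the power m³ can be lowered to m² and to m respectively.
  module _ {m n X t : ℤ} (1≤m : 1ℤ ≤ m) (0≤X : 0ℤ ≤ X) (0≤t : 0ℤ ≤ t)
           (h : + 8 * (m * m * m) * (X + t) < + 3 * (n * n)) where

    private
      0≤m = 1≤⇒0≤ 1≤m

    centre-degree : m * m * X ≤ n * n
    centre-degree = *-cancelˡ-≤-pos (m * m * X) (n * n) (+ 3)
      (cert (gap (<⇒≤ h) ⊕ 0≤m ⊗ 0≤m ⊗ 0≤X ⊗ (lit 8 ⊗ gap 1≤m ⊕ lit 5)
             ⊕ lit 8 ⊗ (0≤m ⊗ 0≤m ⊗ 0≤m) ⊗ 0≤t) eq)
      where
      eq : + 3 * (n * n) - + 8 * (m * m * m) * (X + t)
           + m * m * X * (+ 8 * (m - 1ℤ) + + 5) + + 8 * (m * m * m) * t ≡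
           + 3 * (n * n) - + 3 * (m * m * X)
      eq = solve (m ∷ n ∷ X ∷ t ∷ [])

    centre-triangles : + 8 * (m * t) ≤ + 3 * (n * n)
    centre-triangles =
      cert (gap (<⇒≤ h) ⊕ lit 8 ⊗ (0≤m ⊗ 0≤m ⊗ 0≤m) ⊗ 0≤X
            ⊕ lit 8 ⊗ 0≤t ⊗ (0≤m ⊗ gap 1≤m ⊗ (0≤m ⊕ lit 1))) eq
      where
      eq : + 3 * (n * n) - + 8 * (m * m * m) * (X + t) + + 8 * (m * m * m) * X
           + + 8 * t * (m * (m - 1ℤ) * (m + 1ℤ)) ≡ + 3 * (n * n) - + 8 * (m * t)
      eq = solve (m ∷ n ∷ X ∷ t ∷ [])

  -- The bracket equals m (n - 2 d) + n, which is at most 2 n. So the three summands of the last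
  -- hypothesis are at most 2 n², n²/4 and 3 n²/4, and the conclusion has n²/2 to spare.
  few-missing : ∀ {m n d s t M} → 0ℤ ≤ n → 0ℤ ≤ d → d ≤ n → 0ℤ ≤ s →
    m * (n - + 2 * d) ≤ n → + 4 * m * s ≤ n → + 8 * (m * t) ≤ + 3 * (n * n) →
    + 2 * m * M ≤ d * (+ 2 * m * (n - d) - (m - 1ℤ) * n) + (m - 1ℤ) * n * s + + 2 * m * t →
    m * M ≤ + 2 * (n * n)
  few-missing {m} {n} {d} {s} {t} {M} 0≤n 0≤d d≤n 0≤s deg low tri h =
    *-cancelˡ-≤-pos (m * M) (+ 2 * (n * n)) (+ 8)
      (cert (lit 4 ⊗ gap h ⊕ lit 4 ⊗ 0≤d ⊗ gap deg ⊕ lit 8 ⊗ 0≤n ⊗ gap d≤n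
             ⊕ 0≤n ⊗ gap low ⊕ lit 4 ⊗ 0≤n ⊗ 0≤s ⊕ gap tri ⊕ lit 4 ⊗ square-nonneg n) eq)
    where
    eq : + 4 * (d * (+ 2 * m * (n - d) - (m - 1ℤ) * n) + (m - 1ℤ) * n * s + + 2 * m * t
                - + 2 * m * M)
         + + 4 * d * (n - m * (n - + 2 * d)) + + 8 * n * (n - d)
         + n * (n - + 4 * m * s) + + 4 * n * s + (+ 3 * (n * n) - + 8 * (m * t))
         + + 4 * (n * n) ≡ + 8 * (+ 2 * (n * n)) - + 8 * (m * M)
    eq = solve (m ∷ n ∷ d ∷ s ∷ t ∷ M ∷ [])

  -- Deleting s vertices of degree at most (1 - 1/m) n/2 lowers 2 E by at most 2 (1 - 1/m) n s,
  -- whereas the square of the order drops by 2 n s - s². The surplus 2 n s/m - s² is nonnegative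
  -- because s ≤ n/(4 m).
  dense-core : ∀ {m n s E E′ D} → 1ℤ ≤ m → 0ℤ ≤ n → 0ℤ ≤ s → + 4 * m * s ≤ n →
    n * n + 1ℤ ≤ + 2 * E → E - + 2 * D ≤ E′ → + 2 * m * D ≤ (m - 1ℤ) * n * s →
    1ℤ ≤ + 2 * E′ - (n - s) * (n - s)
  dense-core {m} {n} {s} {E} {E′} {D} 1≤m 0≤n 0≤s low dense core D≤ =
    *-cancelˡ-≤-pos 1ℤ (+ 2 * E′ - (n - s) * (n - s)) m {{positive (<-≤-trans (+<+ ℕ.z<s) 1≤m)}}
      (cert (lit 2 ⊗ 0≤m ⊗ gap core ⊕ 0≤m ⊗ gap dense ⊕ lit 2 ⊗ gap D≤
             ⊕ 0≤s ⊗ gap low ⊕ 0≤s ⊗ 0≤n ⊕ lit 3 ⊗ 0≤m ⊗ square-nonneg s) eq)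
    where
    0≤m = 1≤⇒0≤ 1≤m
    eq : + 2 * m * (E′ - (E - + 2 * D)) + m * (+ 2 * E - (n * n + 1ℤ))
         + + 2 * ((m - 1ℤ) * n * s - + 2 * m * D) + s * (n - + 4 * m * s) + s * n
         + + 3 * m * (s * s) ≡ m * (+ 2 * E′ - (n - s) * (n - s)) - m * 1ℤ
    eq = solve (m ∷ n ∷ s ∷ E ∷ E′ ∷ D ∷ [])

  core-order : ∀ {m n s} → 1ℤ ≤ m → 1ℤ ≤ n → 0ℤ ≤ s → + 4 * m * s ≤ n → 1ℤ ≤ n - s
  core-order {m} {n} {s} 1≤m 1≤n 0≤s low with 1ℤ ≤? n - s
  ... | yes p = p
  ... | no ¬p = ⊥-elim (absurd
    (lit 4 ⊗ gap (≤-suc (≰⇒> ¬p)) ⊕ gap low ⊕ lit 4 ⊗ gap 1≤m ⊗ 0≤s ⊕ lit 3 ⊗ gap 1≤n) eq)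
    where
    eq : + 4 * (1ℤ - (1ℤ + (n - s))) + (n - + 4 * m * s) + + 4 * (m - 1ℤ) * s
         + + 3 * (n - 1ℤ) ≡ -[1+ 2 ]
    eq = solve (m ∷ n ∷ s ∷ [])

  -- The larger part satisfies P ≥ (1 - 1/m) n/4 with m = 256 k, so 4 k P - (k - 1) n ≥ 255 n/256.
  -- Multiplied by Q ≥ n/16 this is 255 n²/4096, but the missing pairs account for at most 4 k M ≤
  -- 128 n²/4096.
  spread-absurd : ∀ {k n P Q M} → 1ℤ ≤ k → 1ℤ ≤ n →
    + 256 * k * (n - + 2 * (P + Q)) ≤ n → Q ≤ P → n ≤ + 16 * Q →
    + 4 * k * (Q * P) ≤ Q * ((k - 1ℤ) * n) + + 4 * k * M →
    + 256 * k * M ≤ + 2 * (n * n) → ⊥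
  spread-absurd {k} {n} {P} {Q} {M} 1≤k 1≤n high Q≤P large book missing = absurd
    (lit 16 ⊗ ((lit 256 ⊗ 0≤k) ⊗ gap book
       ⊕ 0≤k ⊗ 0≤Q ⊗ (gap high ⊕ lit 512 ⊗ 0≤k ⊗ gap Q≤P)
       ⊕ lit 4 ⊗ 0≤k ⊗ gap missing)
     ⊕ lit 255 ⊗ 0≤k ⊗ 0≤n ⊗ gap large
     ⊕ lit 127 ⊗ 0≤k ⊗ gap 1≤n ⊗ (0≤n ⊕ lit 1)
     ⊕ lit 127 ⊗ gap 1≤k)
    eq
    where
    0≤k = 1≤⇒0≤ 1≤k
    0≤n = 1≤⇒0≤ 1≤n
    0≤Q : 0ℤ ≤ Q
    0≤Q = *-cancelˡ-≤-pos 0ℤ Q (+ 16) (≤-trans 0≤n large)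
    eq : + 16 * (+ 256 * k * (Q * ((k - 1ℤ) * n) + + 4 * k * M - + 4 * k * (Q * P))
           + k * Q * (n - + 256 * k * (n - + 2 * (P + Q)) + + 512 * k * (P - Q))
           + + 4 * k * (+ 2 * (n * n) - + 256 * k * M))
         + + 255 * k * n * (+ 16 * Q - n)
         + + 127 * k * (n - 1ℤ) * (n + 1ℤ)
         + + 127 * (k - 1ℤ) ≡ -[1+ 126 ]
    eq = solve (k ∷ n ∷ P ∷ Q ∷ M ∷ [])

  -- The hypotheses force c ≥ n/2 - n/8 - 3 n/(2 m) with m = 256 k, which is more than n/4, while
  -- the book bound keeps c below n/4.
  same-side-absurd : ∀ {k n B c Px Qx Py Qy} → 1ℤ ≤ k → 1ℤ ≤ n →
    + 256 * k * (n - + 2 * (Px + Qx)) ≤ n → + 256 * k * (n - + 2 * (Py + Qy)) ≤ n →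
    + 16 * Px ≤ n → + 16 * Py ≤ n → + 256 * k * (+ 2 * B - n) ≤ n →
    Qx + Qy - B ≤ c → + 4 * k * c ≤ (k - 1ℤ) * n → ⊥
  same-side-absurd {k} {n} {B} {c} {Px} {Qx} {Py} {Qy}
    1≤k 1≤n highx highy fewx fewy side common book = absurd
    (lit 2 ⊗ (lit 512 ⊗ 0≤k ⊗ gap book ⊕ lit 2048 ⊗ 0≤k ⊗ 0≤k ⊗ gap common
              ⊕ lit 4 ⊗ 0≤k ⊗ (gap highx ⊕ gap highy ⊕ gap side))
     ⊕ lit 256 ⊗ 0≤k ⊗ 0≤k ⊗ (gap fewx ⊕ gap fewy)
     ⊕ lit 512 ⊗ 0≤k ⊗ 0≤k ⊗ 0≤n ⊕ lit 1000 ⊗ 0≤k ⊗ gap 1≤n ⊕ lit 1000 ⊗ gap 1≤k)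
    eq
    where
    0≤k = 1≤⇒0≤ 1≤k
    0≤n = 1≤⇒0≤ 1≤n
    eq : + 2 * (+ 512 * k * ((k - 1ℤ) * n - + 4 * k * c)
           + + 2048 * k * k * (c - (Qx + Qy - B))
           + + 4 * k * (n - + 256 * k * (n - + 2 * (Px + Qx))
                        + (n - + 256 * k * (n - + 2 * (Py + Qy)))
                        + (n - + 256 * k * (+ 2 * B - n))))
         + + 256 * k * k * (n - + 16 * Px + (n - + 16 * Py))
         + + 512 * k * k * n + + 1000 * k * (n - 1ℤ) + + 1000 * (k - 1ℤ) ≡ -[1+ 999 ]
    eq = solve (k ∷ n ∷ B ∷ c ∷ Px ∷ Qx ∷ Py ∷ Qy ∷ [])

  Bit : ℤ → Set
  Bit i = i ≡ 0ℤ ⊎ i ≡ 1ℤ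

  bit-nonneg : ∀ {i} → Bit i → 0ℤ ≤ i
  bit-nonneg (inj₁ refl) = lit 0
  bit-nonneg (inj₂ refl) = lit 1

  bit-≤1 : ∀ {i} → Bit i → i ≤ 1ℤ
  bit-≤1 (inj₁ refl) = lit 1
  bit-≤1 (inj₂ refl) = ≤-refl

  bit-positive : ∀ {i} → Bit i → 0ℤ < i → i ≡ 1ℤ
  bit-positive (inj₁ refl) (+<+ ())
  bit-positive (inj₂ i≡1)  _ = i≡1

  pigeonhole : {A₁ A₂ A₃ B₁ B₂ B₃ : Set} → A₁ ⊎ B₁ → A₂ ⊎ B₂ → A₃ ⊎ B₃ →
    (A₁ → A₂ → ⊥) → (A₁ → A₃ → ⊥) → (A₂ → A₃ → ⊥) →
    (B₁ → B₂ → ⊥) → (B₁ → B₃ → ⊥) → (B₂ → B₃ → ⊥) → ⊥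
  pigeonhole (inj₁ p) (inj₁ q) _        f _ _ _ _ _ = f p q
  pigeonhole (inj₁ p) (inj₂ _) (inj₁ r) _ f _ _ _ _ = f p r
  pigeonhole (inj₂ _) (inj₁ q) (inj₁ r) _ _ f _ _ _ = f q r
  pigeonhole (inj₂ p) (inj₂ q) _        _ _ _ f _ _ = f p q
  pigeonhole (inj₂ p) (inj₁ _) (inj₂ r) _ _ _ _ f _ = f p r
  pigeonhole (inj₁ _) (inj₂ q) (inj₂ r) _ _ _ _ _ f = f q r

  -- With m = 256 k, the number of low-degree vertices and the deviations at the
  -- central vertex u are of order n/m once 8 m³ triSum < n³. The factor 256 leaves
  -- room for the cut-off n/16 used to decide whether a vertex has many neighbours
  -- on a side.
  threshold : ℤ → ℤ
  threshold k = let m = + 256 * k in + 8 * (m * m * m)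

  0≤threshold : ∀ k → 0ℤ ≤ k → 0ℤ ≤ threshold k
  0≤threshold k 0≤k = let 0≤m = lit 256 ⊗ 0≤k in lit 8 ⊗ (0≤m ⊗ 0≤m ⊗ 0≤m)

  -- Counting in symmetric 0/1 matrices

  module Matrix {N : ℕ} (a : Fin N → Fin N → ℤ)
                (symm : ∀ i j → a i j ≡ a j i) (bit : ∀ i j → Bit (a i j)) where

    0≤a : ∀ i j → 0ℤ ≤ a i j
    0≤a i j = bit-nonneg (bit i j)

    a≤1 : ∀ i j → a i j ≤ 1ℤ
    a≤1 i j = bit-≤1 (bit i j)

    deg : Fin N → ℤ
    deg i = ∑ (a i)

    codeg : Fin N → Fin N → ℤ
    codeg i j = ∑ λ k → a i k * a j k

    degSum : ℤ
    degSum = ∑ deg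

    -- Twice the number of triangles at i.
    triDeg : Fin N → ℤ
    triDeg i = ∑ λ j → a i j * codeg i j

    triSum : ℤ
    triSum = ∑ triDeg

    missing : (α β : Fin N → ℤ) → ℤ
    missing α β = ∑ λ i → α i * ∑ λ j → β j * (1ℤ - a i j)

    0≤deg : ∀ i → 0ℤ ≤ deg i
    0≤deg i = ∑-nonneg (0≤a i)

    deg≤N : ∀ i → deg i ≤ + N
    deg≤N i = subst (deg i ≤_) (trans (∑-const N 1ℤ) (*-identityʳ (+ N))) (∑-mono (a≤1 i))

    0≤codeg : ∀ i j → 0ℤ ≤ codeg i j
    0≤codeg i j = ∑-nonneg λ k → 0≤a i k ⊗ 0≤a j k

    0≤triDeg : ∀ i → 0ℤ ≤ triDeg i
    0≤triDeg i = ∑-nonneg λ j → 0≤a i j ⊗ 0≤codeg i j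

    missing-comm : ∀ α β → missing α β ≡ missing β α
    missing-comm α β = begin
      ∑ (λ i → α i * ∑ λ j → β j * (1ℤ - a i j))
        ≡⟨ (sum-cong-≗ λ i → *-distribˡ-sum (α i) λ j → β j * (1ℤ - a i j)) ⟩
      ∑ (λ i → ∑ λ j → α i * (β j * (1ℤ - a i j)))
        ≡⟨ ∑-comm (λ i j → α i * (β j * (1ℤ - a i j))) ⟩
      ∑ (λ j → ∑ λ i → α i * (β j * (1ℤ - a i j)))
        ≡⟨ (sum-cong-≗ λ j → sum-cong-≗ λ i →
              trans (cong (λ x → α i * (β j * (1ℤ - x))) (symm i j))
                    (exchange (α i) (β j) (1ℤ - a j i))) ⟩
      ∑ (λ j → ∑ λ i → β j * (α i * (1ℤ - a j i)))
        ≡⟨ (sum-cong-≗ λ j → *-distribˡ-sum (β j) λ i → α i * (1ℤ - a j i)) ⟨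
      ∑ (λ j → β j * ∑ λ i → α i * (1ℤ - a j i)) ∎
      where
      open ≡-Reasoning
      exchange : ∀ x y z → x * (y * z) ≡ y * (x * z)
      exchange = solve-∀

    private
      module U = Weighted a (λ _ → 1ℤ)

      U-deg : ∀ i → U.deg i ≡ deg i
      U-deg i = sum-cong-≗ λ j → *-identityˡ (a i j)

      U-order : U.order ≡ + N
      U-order = trans (∑-const N 1ℤ) (*-identityʳ (+ N))

      U-codeg : ∀ i j → U.codeg i j ≡ codeg i j
      U-codeg i j = sum-cong-≗ λ k → *-identityˡ (a i k * a j k)

      U-degSum : U.degSum ≡ degSum
      U-degSum = sum-cong-≗ λ i → trans (*-identityˡ (U.deg i)) (U-deg i)

      U-triSum : U.triSum ≡ triSum
      U-triSum = sum-cong-≗ λ i → sum-cong-≗ λ j →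
        cong₂ _*_ (*-identityˡ (a i j)) (U-codeg i j)

    deviation : Fin N → ℤ
    deviation i = (+ 2 * deg i - + N) * (+ 2 * deg i - + N)

    degree-variance : ∑ deviation ≤ + 2 * triSum + + N * (+ N * + N - + 2 * degSum)
    degree-variance = subst₂ _≤_
      (sum-cong-≗ λ i → trans (*-identityˡ _)
        (cong₂ (λ d o → (+ 2 * d - o) * (+ 2 * d - o)) (U-deg i) U-order))
      (cong₂ _+_ (cong (+ 2 *_) U-triSum)
        (cong₂ (λ o e → o * (o * o - + 2 * e)) U-order U-degSum))
      (U.degVariance symm 0≤a a≤1 (λ _ → lit 1))

    -- With i the central vertex u, the left-hand side counts the non-neighbours of j in the
    -- complement of the neighbourhood of u.
    codeg-complement : ∀ i j → ∑ (λ k → (1ℤ - a i k) * (1ℤ - a j k)) ≡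
                       + N - deg i - deg j + codeg i j
    codeg-complement i j = begin
      ∑ (λ k → (1ℤ - a i k) * (1ℤ - a j k))
        ≡⟨ sum-cong-≗ (λ k → pointwise (a i k) (a j k)) ⟩
      ∑ (λ k → 1ℤ - a i k - a j k + a i k * a j k)
        ≡⟨ ∑-distrib-+ (λ k → 1ℤ - a i k - a j k) _ ⟩
      ∑ (λ k → 1ℤ - a i k - a j k) + codeg i j
        ≡⟨ cong (_+ codeg i j) (trans (∑-distrib-- (λ k → 1ℤ - a i k) (a j))
             (cong (_- deg j) (trans (∑-distrib-- (λ _ → 1ℤ) (a i))
               (cong (_- deg i) U-order)))) ⟩
      + N - deg i - deg j + codeg i j ∎
      where
      open ≡-Reasoning
      pointwise : ∀ x y → (1ℤ - x) * (1ℤ - y) ≡ 1ℤ - x - y + x * y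
      pointwise = solve-∀

    -- The hypothesis `books` bounds every book by (1 - 1/k) n/4; k will be the denominator of a
    -- rational between α and 1/2.
    module BooksBounded (k : ℤ) (1≤k : 1ℤ ≤ k)
             (books : ∀ i j → a i j ≡ 1ℤ → + 4 * k * codeg i j ≤ (k - 1ℤ) * + N) where

      private
        0≤k = 1≤⇒0≤ 1≤k

      -- Of the pairs (i , j) of neighbours of x with i in α and j in β, the adjacent
      -- ones are triangles on the edge xj and the others are missing pairs.
      spread : ∀ {α β : Fin N → ℤ} → (∀ i → 0ℤ ≤ α i) → (∀ i → α i ≤ 1ℤ) → (∀ i → 0ℤ ≤ β i) →
        ∀ x → let P = ∑ (λ i → α i * a x i); Q = ∑ (λ i → β i * a x i) in
        + 4 * k * (Q * P) ≤ Q * ((k - 1ℤ) * + N) + + 4 * k * missing β α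
      spread {α} {β} 0≤α α≤1 0≤β x = subst₂ _≤_ lhs rhs (∑-mono term)
        where
        P = ∑ λ i → α i * a x i
        Q = ∑ λ i → β i * a x i
        r : Fin N → ℤ
        r j = ∑ λ i → α i * (1ℤ - a j i)

        common : ∀ j → P ≤ codeg x j + r j
        common j = subst (P ≤_) (∑-distrib-+ (λ i → a x i * a j i) _)
          (∑-mono λ i → cert
            (0≤α i ⊗ gap (a≤1 x i) ⊗ gap (a≤1 j i) ⊕ 0≤a x i ⊗ 0≤a j i ⊗ gap (α≤1 i))
            (eq (α i) (a x i) (a j i)))
          where
          eq : ∀ α x y → α * (1ℤ - x) * (1ℤ - y) + x * y * (1ℤ - α) ≡
                         x * y + α * (1ℤ - y) - α * x
          eq = solve-∀

        row : ∀ j e → Bit e → (e ≡ 1ℤ → + 4 * k * codeg x j ≤ (k - 1ℤ) * + N) →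
          β j * e * (+ 4 * k * P) ≤ β j * e * ((k - 1ℤ) * + N) + + 4 * k * (β j * r j)
        row j _ (inj₁ refl) _ = cert (lit 4 ⊗ 0≤k ⊗ (0≤β j ⊗ ∑-nonneg λ i → 0≤α i ⊗ gap (a≤1 j i)))
          (eq (β j) (+ 4 * k * P) ((k - 1ℤ) * + N) (+ 4 * k * (β j * r j)))
          where
          eq : ∀ b p q c → c ≡ b * 0ℤ * q + c - b * 0ℤ * p
          eq = solve-∀
        row j _ (inj₂ refl) small = cert
          (0≤β j ⊗ (gap (small refl) ⊕ lit 4 ⊗ 0≤k ⊗ gap (common j)))
          (eq k (β j) P ((k - 1ℤ) * + N) (codeg x j) (r j))
          where
          eq : ∀ k b p q c r → b * (q - + 4 * k * c + + 4 * k * (c + r - p)) ≡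
               b * 1ℤ * q + + 4 * k * (b * r) - b * 1ℤ * (+ 4 * k * p)
          eq = solve-∀

        term : ∀ j → β j * a x j * (+ 4 * k * P) ≤
                     β j * a x j * ((k - 1ℤ) * + N) + + 4 * k * (β j * r j)
        term j = row j (a x j) (bit x j) (books x j)

        lhs : ∑ (λ j → β j * a x j * (+ 4 * k * P)) ≡ + 4 * k * (Q * P)
        lhs = trans (sym (*-distribʳ-sum (+ 4 * k * P) λ j → β j * a x j)) (eq k Q P)
          where
          eq : ∀ k q p → q * (+ 4 * k * p) ≡ + 4 * k * (q * p)
          eq = solve-∀

        rhs : ∑ (λ j → β j * a x j * ((k - 1ℤ) * + N) + + 4 * k * (β j * r j)) ≡
              Q * ((k - 1ℤ) * + N) + + 4 * k * missing β α
        rhs = trans (∑-distrib-+ (λ j → β j * a x j * ((k - 1ℤ) * + N)) _)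
          (cong₂ _+_ (sym (*-distribʳ-sum ((k - 1ℤ) * + N) λ j → β j * a x j))
                     (sym (*-distribˡ-sum (+ 4 * k) λ j → β j * r j)))

      -- Inclusion-exclusion inside the part β; common neighbours in the part α only add to
      -- `codeg x y`.
      common-neighbours : ∀ {α β : Fin N → ℤ} → (∀ i → 0ℤ ≤ α i) → (∀ i → 0ℤ ≤ β i) →
        (∀ i → α i + β i ≡ 1ℤ) → ∀ x y →
        ∑ (λ i → β i * a x i) + ∑ (λ i → β i * a y i) - ∑ β ≤ codeg x y
      common-neighbours {α} {β} 0≤α 0≤β α+β≡1 x y = subst (_≤ codeg x y) expand
        (∑-mono λ i → cert
          (0≤β i ⊗ gap (a≤1 x i) ⊗ gap (a≤1 y i) ⊕ 0≤α i ⊗ (0≤a x i ⊗ 0≤a y i))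
          (pointwise (α i) (β i) (a x i) (a y i) (α+β≡1 i)))
        where
        pointwise : ∀ α β x y → α + β ≡ 1ℤ →
          β * (1ℤ - x) * (1ℤ - y) + α * (x * y) ≡ x * y - (β * x + β * y - β)
        pointwise α β x y α+β≡1 = trans (eq α β x y)
          (trans (cong (λ s → s * (x * y) - (β * x + β * y - β)) α+β≡1)
                 (cong (_- (β * x + β * y - β)) (*-identityˡ (x * y))))
          where
          eq : ∀ α β x y → β * (1ℤ - x) * (1ℤ - y) + α * (x * y) ≡
                           (α + β) * (x * y) - (β * x + β * y - β)
          eq = solve-∀
        expand : ∑ (λ i → β i * a x i + β i * a y i - β i) ≡
                 ∑ (λ i → β i * a x i) + ∑ (λ i → β i * a y i) - ∑ β
        expand = trans (∑-distrib-- (λ i → β i * a x i + β i * a y i) β)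
          (cong (_- ∑ β) (∑-distrib-+ (λ i → β i * a x i) _))

      -- Contradiction from few triangles

      module FewTriangles (1≤N : 1ℤ ≤ + N) (dense : + N * + N + 1ℤ ≤ + 2 * degSum)
               (few : threshold k * triSum < + N * + N * + N) where

        m n : ℤ
        m = + 256 * k
        n = + N

        private
          1≤m : 1ℤ ≤ m
          1≤m = cert (lit 256 ⊗ gap 1≤k ⊕ lit 255) (eq k)
            where
            eq : ∀ k → + 256 * (k - 1ℤ) + + 255 ≡ + 256 * k - 1ℤ
            eq = solve-∀
          0≤m = 1≤⇒0≤ 1≤m
          0≤n = 1≤⇒0≤ 1≤N

        -- By `dense`, the second term of `degree-variance` is not positive.
        deviation-sum : ∑ deviation ≤ + 2 * triSum
        deviation-sum = ≤-trans degree-variance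
          (cert (0≤n ⊗ (gap dense ⊕ lit 1)) (eq triSum n degSum))
          where
          eq : ∀ t n e → n * (+ 2 * e - (n * n + 1ℤ) + 1ℤ) ≡
               + 2 * t - (+ 2 * t + n * (n * n - + 2 * e))
          eq = solve-∀

        High : Fin N → Set
        High i = m * (n - + 2 * deg i) ≤ n

        -- The indicator is produced together with its specification, so that matching on `low i`
        -- and `low-spec i` at once replaces the indicator by a literal.
        lowBit : ∀ i → ∃[ s ] (s ≡ 1ℤ × n ≤ m * (n - + 2 * deg i) ⊎ s ≡ 0ℤ × High i)
        lowBit i with n ≤? m * (n - + 2 * deg i)
        ... | yes low = 1ℤ , inj₁ (refl , low)
        ... | no ¬low = 0ℤ , inj₂ (refl , <⇒≤ (≰⇒> ¬low))

        low : Fin N → ℤ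
        low i = let s , _ = lowBit i in s

        low-spec : ∀ i → low i ≡ 1ℤ × n ≤ m * (n - + 2 * deg i) ⊎ low i ≡ 0ℤ × High i
        low-spec i = let _ , spec = lowBit i in spec

        0≤low : ∀ i → 0ℤ ≤ low i
        0≤low i with low i | low-spec i
        ... | _ | inj₁ (refl , _) = lit 1
        ... | _ | inj₂ (refl , _) = lit 0

        low≤1 : ∀ i → low i ≤ 1ℤ
        low≤1 i with low i | low-spec i
        ... | _ | inj₁ (refl , _) = ≤-refl
        ... | _ | inj₂ (refl , _) = lit 1

        #low : ℤ
        #low = ∑ low

        0≤#low : 0ℤ ≤ #low
        0≤#low = ∑-nonneg 0≤low

        -- Chebyshev's argument: a low vertex has deviation at least n²/m², and all deviations add
        -- up to at most 2 `triSum`.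
        #low-small : + 4 * m * #low ≤ n
        #low-small = few-low {m} {n} {#low} {triSum} 1≤m (begin
          #low * (n * n)                    ≡⟨ *-distribʳ-sum (n * n) low ⟩
          ∑ (λ i → low i * (n * n))         ≤⟨ ∑-mono term ⟩
          ∑ (λ i → m * m * deviation i)     ≡⟨ *-distribˡ-sum (m * m) deviation ⟨
          m * m * ∑ deviation               ≤⟨ cert (0≤m ⊗ 0≤m ⊗ gap deviation-sum)
                                                 (*-distribˡ-- (m * m) (+ 2 * triSum) (∑ deviation)) ⟩
          m * m * (+ 2 * triSum)            ∎) few
          where
          open ≤-Reasoning
          *-distribˡ-- : ∀ x y z → x * (y - z) ≡ x * y - x * z
          *-distribˡ-- = solve-∀
          term : ∀ i → low i * (n * n) ≤ m * m * deviation i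
          term i with low i | low-spec i
          ... | _ | inj₁ (refl , l) =
            subst (_≤ m * m * deviation i) (sym (*-identityˡ (n * n))) (low⇒square {m} {n} {deg i} 0≤n l)
          ... | _ | inj₂ (refl , _) = 0≤m ⊗ 0≤m ⊗ square-nonneg (+ 2 * deg i - n)

        private
          high : Fin N → ℤ
          high i = 1ℤ - low i

          0≤high : ∀ i → 0ℤ ≤ high i
          0≤high i = gap (low≤1 i)

          -- Weights 0 and 1 represent the subgraph induced on the high vertices without reindexing
          -- them.
          module V = Weighted a high

          V-order : V.order ≡ n - #low
          V-order = trans (∑-distrib-- (λ _ → 1ℤ) low) (cong (_- #low) U-order)

          lowDegSum : ℤ
          lowDegSum = ∑ λ i → low i * deg i

          lowDegSum-≤ : + 2 * m * lowDegSum ≤ (m - 1ℤ) * n * #low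
          lowDegSum-≤ = subst₂ _≤_ (sym (*-distribˡ-sum (+ 2 * m) λ i → low i * deg i))
            (sym (*-distribˡ-sum ((m - 1ℤ) * n) low)) (∑-mono term)
            where
            eq₁ : ∀ m n d → m * (n - + 2 * d) - n ≡
                  (m - 1ℤ) * n * 1ℤ - + 2 * m * (1ℤ * d)
            eq₁ = solve-∀
            eq₀ : ∀ m n d → 0ℤ ≡ (m - 1ℤ) * n * 0ℤ - + 2 * m * (0ℤ * d)
            eq₀ = solve-∀
            term : ∀ i → + 2 * m * (low i * deg i) ≤ (m - 1ℤ) * n * low i
            term i with low i | low-spec i
            ... | _ | inj₁ (refl , l) = cert (gap l) (eq₁ m n (deg i))
            ... | _ | inj₂ (refl , _) = cert (lit 0) (eq₀ m n (deg i))

          -- The lost ordered pairs have a low first or a low second entry, and each kind amounts to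
          -- `lowDegSum`. Pairs with both entries low are subtracted twice, hence only an
          -- inequality.
          core-degSum : degSum - + 2 * lowDegSum ≤ V.degSum
          core-degSum = subst (_≤ V.degSum) expand (∑-mono term)
            where
            lowDeg : Fin N → ℤ
            lowDeg i = ∑ λ j → low j * a i j
            0≤lowDeg : ∀ i → 0ℤ ≤ lowDeg i
            0≤lowDeg i = ∑-nonneg λ j → 0≤low j ⊗ 0≤a i j
            V-deg : ∀ i → V.deg i ≡ deg i - lowDeg i
            V-deg i = trans (sum-cong-≗ λ j → pointwise (low j) (a i j)) (∑-distrib-- (a i) _)
              where
              pointwise : ∀ s x → (1ℤ - s) * x ≡ x - s * x
              pointwise = solve-∀
            eq : ∀ s d g → s * g ≡ (1ℤ - s) * (d - g) - (d - (s * d + g))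
            eq = solve-∀
            term : ∀ i → deg i - (low i * deg i + lowDeg i) ≤ high i * V.deg i
            term i = subst (λ e → deg i - (low i * deg i + lowDeg i) ≤ high i * e) (sym (V-deg i))
              (cert (0≤low i ⊗ 0≤lowDeg i) (eq (low i) (deg i) (lowDeg i)))
            lowDeg-sum : ∑ lowDeg ≡ lowDegSum
            lowDeg-sum = trans (∑-comm (λ i j → low j * a i j)) (sum-cong-≗ λ j →
              trans (sum-cong-≗ λ i → cong (low j *_) (symm i j))
                    (sym (*-distribˡ-sum (low j) (a j))))
            double : ∀ e x → e - (x + x) ≡ e - + 2 * x
            double = solve-∀
            expand : ∑ (λ i → deg i - (low i * deg i + lowDeg i)) ≡ degSum - + 2 * lowDegSum
            expand = trans (∑-distrib-- deg _)
              (trans (cong (λ x → degSum - x) (trans (∑-distrib-+ (λ i → low i * deg i) lowDeg)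
                       (cong (λ x → lowDegSum + x) lowDeg-sum)))
                     (double degSum lowDegSum))

          -- Mantel's theorem: the left-hand side of degVariance is nonnegative.
          core-triangles : 0ℤ < V.triSum
          core-triangles = ≰⇒> λ T≤0 → absurd
            (gap (V.degVariance symm 0≤a a≤1 0≤high)
              ⊕ ∑-nonneg (λ i → 0≤high i ⊗ square-nonneg (+ 2 * V.deg i - V.order))
              ⊕ lit 2 ⊗ gap T≤0 ⊕ gap 1≤order ⊗ 0≤Y ⊕ gap 1≤Y)
            (eq V.triSum V.order V.degSum _)
            where
            1≤order : 1ℤ ≤ V.order
            1≤order = subst (1ℤ ≤_) (sym V-order) (core-order {m} {n} {#low} 1≤m 1≤N 0≤#low #low-small)
            Y : ℤ
            Y = + 2 * V.degSum - V.order * V.order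
            1≤Y : 1ℤ ≤ Y
            1≤Y = subst (λ o → 1ℤ ≤ + 2 * V.degSum - o * o) (sym V-order)
              (dense-core {m} {n} {#low} {degSum} {V.degSum} {lowDegSum} 1≤m 0≤n 0≤#low #low-small
                  dense core-degSum lowDegSum-≤)
            0≤Y = 1≤⇒0≤ 1≤Y
            eq : ∀ t o e v → + 2 * t + o * (o * o - + 2 * e) - v + v + + 2 * (0ℤ - t)
                 + (o - 1ℤ) * (+ 2 * e - o * o) + (+ 2 * e - o * o - 1ℤ) ≡ -1ℤ
            eq = solve-∀

          high-positive : ∀ i → 0ℤ < high i → High i
          high-positive i 0<h with low i | low-spec i
          ... | _ | inj₁ (refl , _) = contradiction 0<h (<-irrefl refl)
          ... | _ | inj₂ (_ , hi)   = hi

        -- A positive sum has a positive term, and a positive product of nonnegative factors has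
        -- positive factors. Applied to `V.triSum`, this extracts the three vertices together with
        -- their weights and adjacencies.
        high-triangle : ∃[ x ] ∃[ y ] ∃[ z ] ((High x × High y × High z) ×
                        (a x y ≡ 1ℤ × a x z ≡ 1ℤ × a y z ≡ 1ℤ))
        high-triangle =
          let x , 0<x        = ∑-positive-witness _ core-triangles
              y , 0<xy       = ∑-positive-witness _ 0<x
              0<hha , 0<c    = *-pos-factors (0≤high x ⊗ 0≤high y ⊗ 0≤a x y)
                                 (∑-nonneg λ k → 0≤high k ⊗ (0≤a x k ⊗ 0≤a y k)) 0<xy
              0<hh , 0<axy   = *-pos-factors (0≤high x ⊗ 0≤high y) (0≤a x y) 0<hha
              0<hx , 0<hy    = *-pos-factors (0≤high x) (0≤high y) 0<hh
              z , 0<z        = ∑-positive-witness _ 0<c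
              0<hz , 0<aa    = *-pos-factors (0≤high z) (0≤a x z ⊗ 0≤a y z) 0<z
              0<axz , 0<ayz  = *-pos-factors (0≤a x z) (0≤a y z) 0<aa
          in x , y , z ,
             (high-positive x 0<hx , high-positive y 0<hy , high-positive z 0<hz) ,
             (bit-positive (bit x y) 0<axy , bit-positive (bit x z) 0<axz ,
              bit-positive (bit y z) 0<ayz)

        -- Averaging over u: the deviations contribute at most 2 `triSum` and the triangle degrees
        -- exactly `triSum`, whence the factor 3. Choosing one u for the sum makes both quantities
        -- small at the same vertex.
        centre : ∃[ u ] + 8 * (m * m * m) * (deviation u + triDeg u) < + 3 * (n * n)
        centre = ∑-<-witness _ _ (begin-strict
          ∑ (λ u → + 8 * (m * m * m) * (deviation u + triDeg u))
            ≡⟨ *-distribˡ-sum (+ 8 * (m * m * m)) (λ u → deviation u + triDeg u) ⟨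
          + 8 * (m * m * m) * ∑ (λ u → deviation u + triDeg u)
            ≡⟨ cong (+ 8 * (m * m * m) *_) (∑-distrib-+ deviation triDeg) ⟩
          + 8 * (m * m * m) * (∑ deviation + triSum)
            ≤⟨ cert (lit 8 ⊗ (0≤m ⊗ 0≤m ⊗ 0≤m) ⊗ gap deviation-sum)
                    (eq (+ 8 * (m * m * m)) (∑ deviation) triSum) ⟩
          + 3 * (+ 8 * (m * m * m) * triSum)
            <⟨ *-monoˡ-<-pos (+ 3) few ⟩
          + 3 * (n * n * n)
            ≡⟨ eq′ n ⟩
          n * (+ 3 * (n * n))
            ≡⟨ ∑-const N (+ 3 * (n * n)) ⟨
          ∑ {N} (λ _ → + 3 * (n * n)) ∎)
          where
          open ≤-Reasoning
          eq : ∀ K v t → K * (+ 2 * t - v) ≡ + 3 * (K * t) - K * (v + t)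
          eq = solve-∀
          eq′ : ∀ n → + 3 * (n * n * n) ≡ n * (+ 3 * (n * n))
          eq′ = solve-∀

        -- The neighbourhood of u and its complement form a nearly complete,
        -- nearly balanced bipartition.
        module Bipartition (u : Fin N)
          (central : + 8 * (m * m * m) * (deviation u + triDeg u) < + 3 * (n * n)) where

          α β : Fin N → ℤ
          α i = a u i
          β i = 1ℤ - a u i

          0≤α : ∀ i → 0ℤ ≤ α i
          0≤α = 0≤a u

          α≤1 : ∀ i → α i ≤ 1ℤ
          α≤1 = a≤1 u

          0≤β : ∀ i → 0ℤ ≤ β i
          0≤β i = gap (a≤1 u i)

          β≤1 : ∀ i → β i ≤ 1ℤ
          β≤1 i = cert (0≤α i) (eq (a u i))
            where
            eq : ∀ x → x ≡ 1ℤ - (1ℤ - x)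
            eq = solve-∀

          private
            d = deg u
            0≤dev = square-nonneg (+ 2 * d - n)

            m²dev≤n² : m * m * deviation u ≤ n * n
            m²dev≤n² = centre-degree {m} {n} {deviation u} {triDeg u} 1≤m 0≤dev (0≤triDeg u) central

          -- This and `centre-high` are the two signs of the square root of `m²dev≤n²`. The latter
          -- also bounds the size of β, which is n - d.
          size-α : m * (+ 2 * ∑ α - n) ≤ n
          size-α = square-cancel-≤ (m * (+ 2 * d - n)) n 0≤n (subst (_≤ n * n) (eq m (+ 2 * d - n)) m²dev≤n²)
            where
            eq : ∀ m x → m * m * (x * x) ≡ m * x * (m * x)
            eq = solve-∀

          centre-high : High u
          centre-high = square-cancel-≤ (m * (n - + 2 * d)) n 0≤n (subst (_≤ n * n) (eq m n d) m²dev≤n²)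
            where
            eq : ∀ m n d → m * m * ((+ 2 * d - n) * (+ 2 * d - n)) ≡
                           m * (n - + 2 * d) * (m * (n - + 2 * d))
            eq = solve-∀

          size-β : m * (+ 2 * ∑ β - n) ≤ n
          size-β = subst (_≤ n) (sym (trans (cong (λ x → m * (+ 2 * x - n)) ∑β) (eq m n d))) centre-high
            where
            ∑β : ∑ β ≡ n - d
            ∑β = trans (∑-distrib-- (λ _ → 1ℤ) (a u)) (cong (_- d) U-order)
            eq : ∀ m n d → m * (+ 2 * (n - d) - n) ≡ m * (n - + 2 * d)
            eq = solve-∀

          missing-small : m * missing α β ≤ + 2 * (n * n)
          missing-small = few-missing {m} {n} {d} {#low} {triDeg u} {missing α β}
            0≤n (0≤deg u) (deg≤N u) 0≤#low centre-high #low-small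
            (centre-triangles {m} {n} {deviation u} {triDeg u} 1≤m 0≤dev (0≤triDeg u) central)
            (subst₂ _≤_ lhs rhs (∑-mono term))
            where
            -- `c₀` charges each i in α as if its degree were at least (1 - 1/m) n/2, which is right
            -- for a high vertex. For a low vertex in α the extra summand (m - 1) n cancels that
            -- assumption.
            c₀ : ℤ
            c₀ = + 2 * m * (n - d) - (m - 1ℤ) * n
            lhs : ∑ (λ i → + 2 * m * (α i * (n - d - deg i + codeg u i))) ≡
                  + 2 * m * missing α β
            lhs = trans (sym (*-distribˡ-sum (+ 2 * m) λ i → α i * (n - d - deg i + codeg u i)))
              (cong (+ 2 * m *_) (sum-cong-≗ λ i → cong (α i *_) (sym (codeg-complement u i))))
            rhs : ∑ (λ i → α i * c₀ + (m - 1ℤ) * n * low i + + 2 * m * (α i * codeg u i)) ≡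
                  d * c₀ + (m - 1ℤ) * n * #low + + 2 * m * triDeg u
            rhs = trans (∑-distrib-+ (λ i → α i * c₀ + (m - 1ℤ) * n * low i) _)
              (cong₂ _+_
                (trans (∑-distrib-+ (λ i → α i * c₀) _)
                  (cong₂ _+_ (sym (*-distribʳ-sum c₀ α)) (sym (*-distribˡ-sum ((m - 1ℤ) * n) low))))
                (sym (*-distribˡ-sum (+ 2 * m) λ i → α i * codeg u i)))
            term : ∀ i → + 2 * m * (α i * (n - d - deg i + codeg u i)) ≤
                         α i * c₀ + (m - 1ℤ) * n * low i + + 2 * m * (α i * codeg u i)
            term i with low i | low-spec i
            ... | _ | inj₁ (refl , _) = cert
              (gap 1≤m ⊗ 0≤n ⊗ 0≤β i ⊕ lit 2 ⊗ 0≤m ⊗ 0≤α i ⊗ 0≤deg i)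
              (eq m n (α i) d (deg i) (codeg u i))
              where
              eq : ∀ m n x d e c → (m - 1ℤ) * n * (1ℤ - x) + + 2 * m * x * e ≡
                   x * (+ 2 * m * (n - d) - (m - 1ℤ) * n) + (m - 1ℤ) * n * 1ℤ + + 2 * m * (x * c)
                   - + 2 * m * (x * (n - d - e + c))
              eq = solve-∀
            ... | _ | inj₂ (refl , hi) = cert (0≤α i ⊗ gap hi) (eq m n (α i) d (deg i) (codeg u i))
              where
              eq : ∀ m n x d e c → x * (n - m * (n - + 2 * e)) ≡
                   x * (+ 2 * m * (n - d) - (m - 1ℤ) * n) + (m - 1ℤ) * n * 0ℤ + + 2 * m * (x * c)
                   - + 2 * m * (x * (n - d - e + c))
              eq = solve-∀

          inα inβ : Fin N → ℤ
          inα x = ∑ λ i → α i * a x i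
          inβ x = ∑ λ i → β i * a x i

          deg-split : ∀ x → deg x ≡ inα x + inβ x
          deg-split x = trans (sum-cong-≗ λ i → eq (a u i) (a x i)) (∑-distrib-+ (λ i → α i * a x i) _)
            where
            eq : ∀ u x → x ≡ u * x + (1ℤ - u) * x
            eq = solve-∀

          -- Otherwise both parts hold more than n/16 neighbours of x. Then `spread`, over the edges
          -- from x into the part with fewer neighbours, contradicts the book bound: such an edge
          -- has on average almost all neighbours of x in the other part as apexes.
          one-sided : ∀ x → High x → + 16 * inα x ≤ n ⊎ + 16 * inβ x ≤ n
          one-sided x hi with + 16 * inα x ≤? n | + 16 * inβ x ≤? n
          ... | yes p | _     = inj₁ p
          ... | no _  | yes q = inj₂ q
          ... | no ¬p | no ¬q with ≤-total (inβ x) (inα x)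
          ...   | inj₁ β≤α = ⊥-elim (spread-absurd {k} {n} {inα x} {inβ x} {missing β α} 1≤k 1≤N
            (subst (λ e → m * (n - + 2 * e) ≤ n) (deg-split x) hi) β≤α (<⇒≤ (≰⇒> ¬q))
            (spread 0≤α α≤1 0≤β x)
            (subst (λ M → m * M ≤ + 2 * (n * n)) (missing-comm α β) missing-small))
          ...   | inj₂ α≤β = ⊥-elim (spread-absurd {k} {n} {inβ x} {inα x} {missing α β} 1≤k 1≤N
            (subst (λ e → m * (n - + 2 * e) ≤ n) (trans (deg-split x) (+-comm (inα x) (inβ x))) hi)
            α≤β (<⇒≤ (≰⇒> ¬p)) (spread 0≤β β≤1 0≤α x) missing-small)

          not-both-β : ∀ x y → High x → High y → a x y ≡ 1ℤ →
                       + 16 * inα x ≤ n → + 16 * inα y ≤ n → ⊥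
          not-both-β x y hx hy xy fewx fewy = same-side-absurd
            {k} {n} {∑ β} {codeg x y} {inα x} {inβ x} {inα y} {inβ y} 1≤k 1≤N
            (subst (λ e → m * (n - + 2 * e) ≤ n) (deg-split x) hx)
            (subst (λ e → m * (n - + 2 * e) ≤ n) (deg-split y) hy)
            fewx fewy size-β
            (common-neighbours 0≤α 0≤β (λ i → eq (a u i)) x y) (books x y xy)
            where
            eq : ∀ x → x + (1ℤ - x) ≡ 1ℤ
            eq = solve-∀

          not-both-α : ∀ x y → High x → High y → a x y ≡ 1ℤ →
                       + 16 * inβ x ≤ n → + 16 * inβ y ≤ n → ⊥
          not-both-α x y hx hy xy fewx fewy = same-side-absurd
            {k} {n} {∑ α} {codeg x y} {inβ x} {inα x} {inβ y} {inα y} 1≤k 1≤N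
            (subst (λ e → m * (n - + 2 * e) ≤ n) (trans (deg-split x) (+-comm (inα x) (inβ x))) hx)
            (subst (λ e → m * (n - + 2 * e) ≤ n) (trans (deg-split y) (+-comm (inα y) (inβ y))) hy)
            fewx fewy size-α
            (common-neighbours 0≤β 0≤α (λ i → eq (a u i)) x y) (books x y xy)
            where
            eq : ∀ x → 1ℤ - x + x ≡ 1ℤ
            eq = solve-∀

          no-high-triangle : ∀ {x y z} → High x → High y → High z →
                             a x y ≡ 1ℤ → a x z ≡ 1ℤ → a y z ≡ 1ℤ → ⊥
          no-high-triangle {x} {y} {z} hx hy hz xy xz yz =
            pigeonhole (one-sided x hx) (one-sided y hy) (one-sided z hz)
              (not-both-β x y hx hy xy) (not-both-β x z hx hz xz) (not-both-β y z hy hz yz)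
              (not-both-α x y hx hy xy) (not-both-α x z hx hz xz) (not-both-α y z hy hz yz)

        contradictory : ⊥
        contradictory =
          let u , central                          = centre
              _ , _ , _ , (hx , hy , hz) , xy , xz , yz = high-triangle
          in Bipartition.no-high-triangle u central hx hy hz xy xz yz

      many-triangles : 1ℤ ≤ + N → + N * + N + 1ℤ ≤ + 2 * degSum →
        + N * + N * + N ≤ threshold k * triSum
      many-triangles 1≤N dense = ≮⇒≥ (FewTriangles.contradictory 1≤N dense)

  -- From lists to sums

  ind : ∀ {P : Set} → Dec P → ℤ
  ind (yes _) = 1ℤ
  ind (no _)  = 0ℤ

  ind-bit : ∀ {P : Set} (P? : Dec P) → Bit (ind P?)
  ind-bit (yes _) = inj₂ refl
  ind-bit (no _)  = inj₁ refl

  ind-true : ∀ {P : Set} (P? : Dec P) → P → ind P? ≡ 1ℤ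
  ind-true (yes _) _ = refl
  ind-true (no ¬p) p = contradiction p ¬p

  ind-holds : ∀ {P : Set} (P? : Dec P) → ind P? ≡ 1ℤ → P
  ind-holds (yes p) _ = p
  ind-holds (no _) ()

  ind-⇔ : ∀ {P Q : Set} (P? : Dec P) (Q? : Dec Q) → (P → Q) → (Q → P) → ind P? ≡ ind Q?
  ind-⇔ (yes p) Q? P→Q _ = sym (ind-true Q? (P→Q p))
  ind-⇔ (no ¬p) (yes q) _ Q→P = contradiction (Q→P q) ¬p
  ind-⇔ (no _) (no _) _ _ = refl

  ind-× : ∀ {P Q : Set} (P? : Dec P) (Q? : Dec Q) → ind (P? ×-dec Q?) ≡ ind P? * ind Q?
  ind-× (yes _) (yes _) = refl
  ind-× (yes _) (no _)  = refl
  ind-× (no _)  (yes _) = refl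
  ind-× (no _)  (no _)  = refl

  ind-disjoint : ∀ {P Q R : Set} (P? : Dec P) (Q? : Dec Q) (R? : Dec R) →
    (P → R) → (Q → R) → ¬ (P × Q) → ind P? + ind Q? ≤ ind R?
  ind-disjoint (yes p) (yes q) R? _ _ disjoint = contradiction (p , q) disjoint
  ind-disjoint (yes p) (no _)  R? P→R _ _ = ≤-reflexive (sym (ind-true R? (P→R p)))
  ind-disjoint (no _)  (yes q) R? _ Q→R _ = ≤-reflexive (sym (ind-true R? (Q→R q)))
  ind-disjoint (no _)  (no _)  R? _ _ _ = bit-nonneg (ind-bit R?)

  ∑-ind-tabulate : ∀ {n} {A : Set} {P : A → Set} (P? : Decidable P) (f : Fin n → A) →
    ∑ (λ i → ind (P? (f i))) ≡ + length (filter P? (tabulate f))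
  ∑-ind-tabulate {ℕ.zero}  P? f = refl
  ∑-ind-tabulate {ℕ.suc n} P? f with P? (f zero) | ∑-ind-tabulate P? (λ i → f (suc i))
  ... | yes _ | ih = cong (λ x → 1ℤ + x) ih
  ... | no _  | ih = trans (+-identityˡ _) ih

  length-filter-map : ∀ {A B : Set} {P : B → Set} (P? : Decidable P) (f : A → B) xs →
    length (filter P? (map f xs)) ≡ length (filter (λ x → P? (f x)) xs)
  length-filter-map P? f [] = refl
  length-filter-map P? f (x ∷ xs) with P? (f x)
  ... | yes _ = cong ℕ.suc (length-filter-map P? f xs)
  ... | no _  = length-filter-map P? f xs

  length-filter-product : ∀ {n} {A B : Set} {P : A × B → Set} (P? : Decidable P)
    (f : Fin n → A) (ys : List B) →
    + length (filter P? (cartesianProduct (tabulate f) ys)) ≡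
    ∑ (λ i → + length (filter (λ y → P? (f i , y)) ys))
  length-filter-product {ℕ.zero}  P? f ys = refl
  length-filter-product {ℕ.suc n} P? f ys = begin
    + length (filter P? (row ++ rest))                       ≡⟨ cong (λ zs → + length zs) (filter-++ P? row rest) ⟩
    + length (filter P? row ++ filter P? rest)               ≡⟨ cong +_ (length-++ (filter P? row)) ⟩
    + (length (filter P? row) ℕ.+ length (filter P? rest))   ≡⟨ pos-+ (length (filter P? row)) _ ⟩
    + length (filter P? row) + + length (filter P? rest)
      ≡⟨ cong₂ _+_ (cong +_ (length-filter-map P? (f zero ,_) ys))
                   (length-filter-product P? (λ i → f (suc i)) ys) ⟩
    ∑ (λ i → + length (filter (λ y → P? (f i , y)) ys))      ∎
    where
    open ≡-Reasoning
    row  = map (f zero ,_) ys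
    rest = cartesianProduct (tabulate (λ i → f (suc i))) ys

  -- Each head of `xs` is cut out of `ys` once, and uniqueness keeps the tail inside what remains.
  -- Used with common neighbours as `xs` and apexes of a book as `ys`.
  unique-⊆⇒length-≤ : ∀ {A : Set} {xs ys : List A} → Unique xs →
    (∀ {x} → x ∈ xs → x ∈ ys) → length xs ℕ.≤ length ys
  unique-⊆⇒length-≤ {xs = []} _ _ = ℕ.z≤n
  unique-⊆⇒length-≤ {xs = x ∷ xs} (x∉xs ∷ unique) xs⊆ys with ∈-∃++ (xs⊆ys (here refl))
  ... | as , bs , refl = ℕ.≤-trans
    (ℕ.s≤s (unique-⊆⇒length-≤ unique xs⊆as++bs))
    (ℕ.≤-reflexive (trans (cong ℕ.suc (length-++ as))
      (trans (sym (ℕ.+-suc (length as) (length bs))) (sym (length-++ as)))))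
    where
    xs⊆as++bs : ∀ {y} → y ∈ xs → y ∈ as ++ bs
    xs⊆as++bs y∈xs with ∈-++⁻ as (xs⊆ys (there y∈xs))
    ... | inj₁ y∈as          = ∈-++⁺ˡ y∈as
    ... | inj₂ (here refl)   = contradiction refl (All.lookup x∉xs y∈xs)
    ... | inj₂ (there y∈bs)  = ∈-++⁺ʳ as y∈bs

  ∑³ : ∀ {n} → (Fin n → Fin n → Fin n → ℤ) → ℤ
  ∑³ f = ∑ λ i → ∑ λ j → ∑ λ k → f i j k

  ∑³-mono : ∀ {n} {f g : Fin n → Fin n → Fin n → ℤ} → (∀ i j k → f i j k ≤ g i j k) → ∑³ f ≤ ∑³ g
  ∑³-mono f≤g = ∑-mono λ i → ∑-mono λ j → ∑-mono λ k → f≤g i j k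

  ∑³-distrib-+ : ∀ {n} (f g : Fin n → Fin n → Fin n → ℤ) →
    ∑³ (λ i j k → f i j k + g i j k) ≡ ∑³ f + ∑³ g
  ∑³-distrib-+ f g =
    trans (sum-cong-≗ λ i → trans (sum-cong-≗ λ j → ∑-distrib-+ (f i j) (g i j))
            (∑-distrib-+ (λ j → ∑ (f i j)) _))
          (∑-distrib-+ (λ i → ∑ λ j → ∑ (f i j)) _)

  ∑³-swapˡ : ∀ {n} (f : Fin n → Fin n → Fin n → ℤ) → ∑³ (λ i j k → f j i k) ≡ ∑³ f
  ∑³-swapˡ f = ∑-comm (λ i j → ∑ (f j i))

  ∑³-swapʳ : ∀ {n} (f : Fin n → Fin n → Fin n → ℤ) → ∑³ (λ i j k → f i k j) ≡ ∑³ f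
  ∑³-swapʳ f = sum-cong-≗ λ i → ∑-comm (λ j k → f i k j)

  -- Edges, triangles and books of a graph as sums

  module GraphCounts {n : ℕ} (G : Graph n) where
    open Graph G

    adj : Fin n → Fin n → ℤ
    adj i j = ind (adj? i j)

    adj-symm : ∀ i j → adj i j ≡ adj j i
    adj-symm i j = ind-⇔ (adj? i j) (adj? j i) symm symm

    adjacent⇒ordered : ∀ {i j} → Adj i j → i Fin.< j ⊎ j Fin.< i
    adjacent⇒ordered {i} {j} ij with Fin.<-cmp i j
    ... | tri< i<j _ _ = inj₁ i<j
    ... | tri≈ _ i≡j _ = contradiction ij (irrefl i≡j)
    ... | tri> _ _ j<i = inj₂ j<i

    open Matrix adj adj-symm (λ i j → ind-bit (adj? i j)) public

    -- An `Edge` is increasing, so (i , j) and (j , i) are never both listed, and either one makes i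
    -- and j adjacent.
    2#edges≤degSum : + 2 * + #edges G ≤ degSum
    2#edges≤degSum = begin
      + 2 * + #edges G                               ≡⟨ double (+ #edges G) ⟩
      + #edges G + + #edges G                        ≡⟨ cong₂ _+_ #edges-∑ (trans #edges-∑ (∑-comm E)) ⟩
      ∑ (λ i → ∑ (E i)) + ∑ (λ i → ∑ λ j → E j i)    ≡⟨ ∑-distrib-+ (λ i → ∑ (E i)) _ ⟨
      ∑ (λ i → ∑ (E i) + ∑ λ j → E j i)              ≡⟨ (sum-cong-≗ λ i → ∑-distrib-+ (E i) _) ⟨
      ∑ (λ i → ∑ λ j → E i j + E j i)                ≤⟨ (∑-mono λ i → ∑-mono λ j → term i j) ⟩
      degSum                                         ∎
      where
      open ≤-Reasoning
      E : Fin n → Fin n → ℤ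
      E i j = ind (isEdge? G (i , j))
      double : ∀ x → + 2 * x ≡ x + x
      double = solve-∀
      #edges-∑ : + #edges G ≡ ∑ (λ i → ∑ (E i))
      #edges-∑ = trans (length-filter-product (isEdge? G) (λ i → i) (allFin n))
        (sum-cong-≗ λ i → sym (∑-ind-tabulate (λ j → isEdge? G (i , j)) (λ j → j)))
      term : ∀ i j → E i j + E j i ≤ adj i j
      term i j = ind-disjoint (isEdge? G (i , j)) (isEdge? G (j , i)) (adj? i j)
        proj₂ (λ (_ , ji) → symm ji) (λ ((i<j , _) , (j<i , _)) → Fin.<-asym i<j j<i)

    -- Three pairwise adjacent vertices are distinct, so one of their six orderings is increasing
    -- and is a listed triangle. Each ordering sums to the same total `T`.
    triSum≤6#triangles : triSum ≤ + 6 * + #triangles G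
    triSum≤6#triangles = begin
      ∑ (λ i → ∑ λ j → adj i j * codeg i j)
        ≡⟨ (sum-cong-≗ λ i → sum-cong-≗ λ j → *-distribˡ-sum (adj i j) λ k → adj i k * adj j k) ⟩
      ∑³ (λ i j k → adj i j * (adj i k * adj j k))
        ≤⟨ ∑³-mono term ⟩
      ∑³ (λ i j k → t i j k + (t i k j + (t j i k + (t j k i + (t k i j + t k j i)))))
        ≡⟨ expand ⟩
      T + (T + (T + (T + (T + T))))
        ≡⟨ six T ⟩
      + 6 * T
        ≡⟨ cong (+ 6 *_) #triangles-∑ ⟨
      + 6 * + #triangles G ∎
      where
      open ≤-Reasoning
      t : Fin n → Fin n → Fin n → ℤ
      t i j k = ind (isTriangle? G (i , j , k))
      T : ℤ
      T = ∑³ t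
      six : ∀ x → x + (x + (x + (x + (x + x)))) ≡ + 6 * x
      six = solve-∀
      #triangles-∑ : + #triangles G ≡ T
      #triangles-∑ = trans
        (length-filter-product (isTriangle? G) (λ i → i) (cartesianProduct (allFin n) (allFin n)))
        (sum-cong-≗ λ i → trans
          (length-filter-product (λ jk → isTriangle? G (i , jk)) (λ j → j) (allFin n))
          (sum-cong-≗ λ j → sym (∑-ind-tabulate (λ k → isTriangle? G (i , j , k)) (λ k → k))))
      expand : ∑³ (λ i j k → t i j k + (t i k j + (t j i k + (t j k i + (t k i j + t k j i))))) ≡
               T + (T + (T + (T + (T + T))))
      expand = peel t (refl {x = T})
        (peel (λ i j k → t i k j) (∑³-swapʳ t)
        (peel (λ i j k → t j i k) (∑³-swapˡ t)
        (peel (λ i j k → t j k i) jki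
        (peel (λ i j k → t k i j) kij kji))))
        where
        peel : ∀ (f : Fin n → Fin n → Fin n → ℤ) {g : Fin n → Fin n → Fin n → ℤ} {x y} →
               ∑³ f ≡ x → ∑³ g ≡ y → ∑³ (λ i j k → f i j k + g i j k) ≡ x + y
        peel f {g} f≡ g≡ = trans (∑³-distrib-+ f g) (cong₂ _+_ f≡ g≡)
        jki : ∑³ (λ i j k → t j k i) ≡ T
        jki = trans (∑³-swapˡ (λ i j k → t i k j)) (∑³-swapʳ t)
        kij : ∑³ (λ i j k → t k i j) ≡ T
        kij = trans (∑³-swapʳ (λ i j k → t j i k)) (∑³-swapˡ t)
        kji : ∑³ (λ i j k → t k j i) ≡ T
        kji = trans (∑³-swapˡ (λ i j k → t k i j)) kij

      0≤t : ∀ i j k → 0ℤ ≤ t i j k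
      0≤t i j k = bit-nonneg (ind-bit (isTriangle? G (i , j , k)))

      term : ∀ i j k → adj i j * (adj i k * adj j k) ≤
             t i j k + (t i k j + (t j i k + (t j k i + (t k i j + t k j i))))
      term i j k = bound (adj? i j) (adj? i k) (adj? j k)
        where
        rhs : ℤ
        rhs = t i j k + (t i k j + (t j i k + (t j k i + (t k i j + t k j i))))
        -- The `z`s record that the suffixes of `rhs` are nonnegative, so a case of `sorted` only
        -- has to exhibit the one summand that is 1.
        z₅ = 0≤t k j i
        z₄ = 0≤t k i j ⊕ z₅
        z₃ = 0≤t j k i ⊕ z₄
        z₂ = 0≤t j i k ⊕ z₃
        z₁ = 0≤t i k j ⊕ z₂
        0≤rhs : 0ℤ ≤ rhs
        0≤rhs = 0≤t i j k ⊕ z₁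
        one : ∀ p q r → IsTriangle G (p , q , r) → 1ℤ ≤ t p q r
        one p q r τ = ≤-reflexive (sym (ind-true (isTriangle? G (p , q , r)) τ))
        sorted : Adj i j → Adj i k → Adj j k → i Fin.< j ⊎ j Fin.< i → i Fin.< k ⊎ k Fin.< i →
                 j Fin.< k ⊎ k Fin.< j → 1ℤ ≤ rhs
        sorted ij ik jk (inj₁ i<j) _ (inj₁ j<k) =
          +-mono-≤ (one i j k ((i<j , j<k) , ij , ik , jk)) z₁
        sorted ij ik jk (inj₁ i<j) (inj₁ i<k) (inj₂ k<j) =
          +-mono-≤ (0≤t i j k) (+-mono-≤ (one i k j ((i<k , k<j) , ik , ij , symm jk)) z₂)
        sorted ij ik jk (inj₂ j<i) (inj₁ i<k) _ =
          +-mono-≤ (0≤t i j k) (+-mono-≤ (0≤t i k j)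
            (+-mono-≤ (one j i k ((j<i , i<k) , symm ij , jk , ik)) z₃))
        sorted ij ik jk (inj₂ j<i) (inj₂ k<i) (inj₁ j<k) =
          +-mono-≤ (0≤t i j k) (+-mono-≤ (0≤t i k j) (+-mono-≤ (0≤t j i k)
            (+-mono-≤ (one j k i ((j<k , k<i) , jk , symm ij , symm ik)) z₄)))
        sorted ij ik jk (inj₁ i<j) (inj₂ k<i) _ =
          +-mono-≤ (0≤t i j k) (+-mono-≤ (0≤t i k j) (+-mono-≤ (0≤t j i k) (+-mono-≤ (0≤t j k i)
            (+-mono-≤ (one k i j ((k<i , i<j) , symm ik , symm jk , ij)) z₅))))
        sorted ij ik jk (inj₂ j<i) (inj₂ k<i) (inj₂ k<j) =
          +-mono-≤ (0≤t i j k) (+-mono-≤ (0≤t i k j) (+-mono-≤ (0≤t j i k) (+-mono-≤ (0≤t j k i)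
            (+-mono-≤ (0≤t k i j) (one k j i ((k<j , j<i) , symm jk , symm ik , symm ij))))))
        bound : (ij : Dec (Adj i j)) (ik : Dec (Adj i k)) (jk : Dec (Adj j k)) →
                ind ij * (ind ik * ind jk) ≤ rhs
        bound (no _)  _       _       = 0≤rhs
        bound (yes _) (no _)  _       = 0≤rhs
        bound (yes _) (yes _) (no _)  = 0≤rhs
        bound (yes ij) (yes ik) (yes jk) =
          sorted ij ik jk (adjacent⇒ordered ij) (adjacent⇒ordered ik) (adjacent⇒ordered jk)

    module _ {i j : Fin n} (i<j : i Fin.< j) (ij : Adj i j) where

      private
        book : List (Triangle n)
        book = filter (λ t → (i , j) ∈? triangleEdges t) (triangles G)

        commonNeighbours : List (Fin n)
        commonNeighbours = filter (λ k → adj? i k ×-dec adj? j k) (allFin n)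

        -- The vertex opposite the edge ij, if the triangle contains that edge. As triangles are
        -- increasing, comparing the first entry with i and the second with j determines the
        -- position of the edge.
        apex : Triangle n → Fin n
        apex (p , q , r) with p Fin.≟ i | q Fin.≟ j
        ... | no _  | _     = p
        ... | yes _ | no _  = q
        ... | yes _ | yes _ = r

        apex-first : ∀ {p q r} → p ≢ i → apex (p , q , r) ≡ p
        apex-first {p} {q} p≢i with p Fin.≟ i | q Fin.≟ j
        ... | no _    | _ = refl
        ... | yes p≡i | _ = contradiction p≡i p≢i

        apex-second : ∀ {q r} → q ≢ j → apex (i , q , r) ≡ q
        apex-second {q} q≢j with i Fin.≟ i | q Fin.≟ j
        ... | yes _  | no _    = refl
        ... | yes _  | yes q≡j = contradiction q≡j q≢j
        ... | no i≢i | _       = contradiction refl i≢i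

        apex-third : ∀ {r} → apex (i , j , r) ≡ r
        apex-third with i Fin.≟ i | j Fin.≟ j
        ... | yes _  | yes _  = refl
        ... | yes _  | no j≢j = contradiction refl j≢j
        ... | no i≢i | _      = contradiction refl i≢i

        ∈-book : ∀ {t} → IsTriangle G t → (i , j) ∈ triangleEdges t → t ∈ book
        ∈-book {p , q , r} τ e∈ = ∈-filter⁺ (λ t → (i , j) ∈? triangleEdges t)
          (∈-filter⁺ (isTriangle? G)
            (∈-cartesianProduct⁺ (∈-allFin p) (∈-cartesianProduct⁺ (∈-allFin q) (∈-allFin r))) τ)
          e∈

        ∈-apexes : ∀ {k t} → t ∈ book → apex t ≡ k → k ∈ map apex book
        ∈-apexes t∈ refl = ∈-map⁺ apex t∈

        common⇒apex : ∀ {k} → Adj i k → Adj j k → k Fin.< i ⊎ i Fin.< k → k Fin.< j ⊎ j Fin.< k →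
                      k ∈ map apex book
        common⇒apex ik jk (inj₁ k<i) _ = ∈-apexes
          (∈-book ((k<i , i<j) , symm ik , symm jk , ij) (there (there (here refl))))
          (apex-first (Fin.<⇒≢ k<i))
        common⇒apex ik jk (inj₂ i<k) (inj₁ k<j) = ∈-apexes
          (∈-book ((i<k , k<j) , ik , ij , symm jk) (there (here refl)))
          (apex-second (Fin.<⇒≢ k<j))
        common⇒apex ik jk (inj₂ _) (inj₂ j<k) = ∈-apexes
          (∈-book ((i<j , j<k) , ij , ik , jk) (here refl)) apex-third

      codeg≤bookSize : codeg i j ≤ + bookSize G (i , j)
      codeg≤bookSize = begin
        codeg i j
          ≡⟨ sum-cong-≗ (λ k → ind-× (adj? i k) (adj? j k)) ⟨
        ∑ (λ k → ind (adj? i k ×-dec adj? j k))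
          ≡⟨ ∑-ind-tabulate (λ k → adj? i k ×-dec adj? j k) (λ k → k) ⟩
        + length commonNeighbours
          ≤⟨ +≤+ (unique-⊆⇒length-≤ (Unique.filter⁺ _ (Unique.allFin⁺ n)) common⊆apexes) ⟩
        + length (map apex book)
          ≡⟨ cong +_ (length-map apex book) ⟩
        + length book ∎
        where
        open ≤-Reasoning
        common⊆apexes : ∀ {k} → k ∈ commonNeighbours → k ∈ map apex book
        common⊆apexes {k} k∈ =
          let _ , ik , jk = ∈-filter⁻ (λ k → adj? i k ×-dec adj? j k) {xs = allFin n} k∈
          in common⇒apex ik jk (adjacent⇒ordered (symm ik)) (adjacent⇒ordered (symm jk))

      bookSize≤b : bookSize G (i , j) ℕ.≤ b G
      bookSize≤b = All.lookup (xs≤max 0 (map (bookSize G) (edges G)))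
        (∈-map⁺ (bookSize G) (∈-filter⁺ (isEdge? G)
          (∈-cartesianProduct⁺ (∈-allFin i) (∈-allFin j)) (i<j , ij)))

      codeg≤b-ordered : codeg i j ≤ + b G
      codeg≤b-ordered = ≤-trans codeg≤bookSize (+≤+ bookSize≤b)

    codeg≤b : ∀ {i j} → adj i j ≡ 1ℤ → codeg i j ≤ + b G
    codeg≤b {i} {j} adj≡1 = byOrder (adjacent⇒ordered ij)
      where
      ij : Adj i j
      ij = ind-holds (adj? i j) adj≡1
      byOrder : i Fin.< j ⊎ j Fin.< i → codeg i j ≤ + b G
      byOrder (inj₁ i<j) = codeg≤b-ordered i<j ij
      byOrder (inj₂ j<i) = subst (_≤ + b G)
        (sum-cong-≗ λ k → *-comm (adj j k) (adj i k)) (codeg≤b-ordered j<i (symm ij))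

  -- The theorem for graphs, over the integers

  square<4⌊square/4⌋+4 : ∀ s → s ℕ.+ 1 ℕ.≤ 4 ℕ.* (s ℕ./ 4 ℕ.+ 1)
  square<4⌊square/4⌋+4 s = begin
    s ℕ.+ 1                              ≡⟨ cong (ℕ._+ 1) (ℕ.m≡m%n+[m/n]*n s 4) ⟩
    s ℕ.% 4 ℕ.+ s ℕ./ 4 ℕ.* 4 ℕ.+ 1      ≤⟨ ℕ.+-monoˡ-≤ 1 (ℕ.+-monoˡ-≤ (s ℕ./ 4 ℕ.* 4) (ℕ.≤-pred (ℕ.m%n<n s 4))) ⟩
    3 ℕ.+ s ℕ./ 4 ℕ.* 4 ℕ.+ 1            ≡⟨ eq (s ℕ./ 4) ⟩
    4 ℕ.* (s ℕ./ 4 ℕ.+ 1)                ∎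
    where
    open ℕ.≤-Reasoning
    eq : ∀ q → 3 ℕ.+ q ℕ.* 4 ℕ.+ 1 ≡ 4 ℕ.* (q ℕ.+ 1)
    eq = ℕ-solve-∀

  triangle-count : ∀ (k : ℤ) → 1ℤ ≤ k → ∀ {n} (G : Graph n) →
    (n ℕ.^ 2) ℕ./ 4 ℕ.+ 1 ℕ.≤ #edges G → + 4 * k * + b G ≤ (k - 1ℤ) * + n →
    + n * + n * + n ≤ + 6 * threshold k * + #triangles G
  -- With no vertices there are no edges, while at least one is required.
  triangle-count k 1≤k {ℕ.zero} G () _
  triangle-count k 1≤k {ℕ.suc n-1} G many-edges small-books = ≤-trans
    (BooksBounded.many-triangles k 1≤k books (+≤+ (ℕ.s≤s ℕ.z≤n)) dense)
    (cert (0≤threshold k 0≤k ⊗ gap triSum≤6#triangles) (eq (threshold k) triSum (+ #triangles G)))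
    where
    open GraphCounts G
    n = ℕ.suc n-1
    0≤k = 1≤⇒0≤ 1≤k
    eq : ∀ c t τ → c * (+ 6 * τ - t) ≡ + 6 * c * τ - c * t
    eq = solve-∀
    books : ∀ i j → adj i j ≡ 1ℤ → + 4 * k * codeg i j ≤ (k - 1ℤ) * + n
    books i j ij = ≤-trans
      (cert (lit 4 ⊗ 0≤k ⊗ gap (codeg≤b ij)) (eq′ k (+ b G) (codeg i j))) small-books
      where
      eq′ : ∀ k b c → + 4 * k * (b - c) ≡ + 4 * k * b - + 4 * k * c
      eq′ = solve-∀
    -- The floor disappears here: n² leaves remainder at most 3 modulo 4, so four times the required
    -- number of edges is at least n² + 1.
    dense : + n * + n + 1ℤ ≤ + 2 * degSum
    dense = begin
      + n * + n + 1ℤ             ≡⟨ cong (λ x → x + 1ℤ) (pos-* n n) ⟨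
      + (n ℕ.* n) + 1ℤ           ≡⟨ cong (λ x → + (n ℕ.* x) + 1ℤ) (ℕ.*-identityʳ n) ⟨
      + (n ℕ.^ 2) + 1ℤ           ≡⟨ pos-+ (n ℕ.^ 2) 1 ⟨
      + (n ℕ.^ 2 ℕ.+ 1)          ≤⟨ +≤+ (ℕ.≤-trans (square<4⌊square/4⌋+4 (n ℕ.^ 2)) (ℕ.*-monoʳ-≤ 4 many-edges)) ⟩
      + (4 ℕ.* #edges G)         ≡⟨ pos-* 4 (#edges G) ⟩
      + 4 * + #edges G           ≡⟨ *-assoc (+ 2) (+ 2) (+ #edges G) ⟩
      + 2 * (+ 2 * + #edges G)   ≤⟨ *-monoˡ-≤-nonNeg (+ 2) 2#edges≤degSum ⟩
      + 2 * degSum               ∎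
      where open ≤-Reasoning

-- Comparison with the real numbers

open Counting
open import Data.Integer as ℤ using (ℤ; 0ℤ; 1ℤ)
import Data.Integer.Properties as ℤ
open import Data.Rational as ℚ using (ℚ)
import Data.Rational.Properties as ℚ
open import Data.Rational.Unnormalised as ℚᵘ using (mkℚᵘ)
import Data.Rational.Unnormalised.Properties as ℚᵘ
open import Data.Nat using (_+_; _^_; _≤_)

-- In unnormalised form the numerator and denominator are the given ones, so comparisons unfold to
-- cross-multiplied integer inequalities.
toℚᵘ-/ : ∀ z d-1 → ℚ.toℚᵘ (z / ℕ.suc d-1) ℚᵘ.≃ mkℚᵘ z d-1
toℚᵘ-/ z d-1 = ℚ.toℚᵘ-fromℚᵘ (mkℚᵘ z d-1)

toℚᵘ-/-* : ∀ z d-1 q → ℚ.toℚᵘ (z / ℕ.suc d-1 ℚ.* q) ℚᵘ.≃ mkℚᵘ z d-1 ℚᵘ.* ℚ.toℚᵘ q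
toℚᵘ-/-* z d-1 q = ℚᵘ.≃-trans (ℚ.toℚᵘ-homo-* (z / ℕ.suc d-1) q)
  (ℚᵘ.*-congʳ {ℚ.toℚᵘ q} (toℚᵘ-/ z d-1))

-- For nonnegative r the lower end of the interval product suffices: q lies below r c for some c in
-- the lower cut, and c is below u.
·-Lower-bound : ∀ (r : ℚ) .{{_ : ℚ.NonNegative r}} (x : ℝ) {q u} →
  ℝ.Lower (r · x) q → (∀ {c} → ℝ.Lower x c → c ℚ.< u) → q ℚ.< r ℚ.* u
·-Lower-bound r x {q} {u} (c , d , Lc , _ , q<) below-u = begin-strict
  q                        <⟨ q< ⟩
  (r ℚ.* c) ℚ.⊓ (r ℚ.* d)  ≤⟨ ℚ.p⊓q≤p (r ℚ.* c) (r ℚ.* d) ⟩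
  r ℚ.* c                  ≤⟨ ℚ.*-monoˡ-≤-nonNeg r (ℚ.<⇒≤ (below-u Lc)) ⟩
  r ℚ.* u                  ∎
  where open ℚ.≤-Reasoning

-- Integrality widens the strict inequality to a gap of one unit; this is the source of k - 1 in the
-- book bound.
<½⇒2↥<↧ : ∀ q → q ℚ.< + 1 / 2 → + 2 ℤ.* ℚ.↥ q ℤ.≤ ℚ.↧ q ℤ.- 1ℤ
<½⇒2↥<↧ q (ℚ.*<* h) = cert (gap (≤-suc h)) (eq (ℚ.↥ q) (ℚ.↧ q))
  where
  eq : ∀ p r → 1ℤ ℤ.* r ℤ.- (1ℤ ℤ.+ p ℤ.* + 2) ≡ r ℤ.- 1ℤ ℤ.- + 2 ℤ.* p
  eq = solve-∀

-- For q = p/r the hypotheses give b < n p/(2 r), hence 4 r b ≤ 2 n p, and 2 p ≤ r - 1.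
small-books : ∀ {α q b n} → ℝ.Upper α q → q ℚ.< + 1 / 2 → fromℕ b <ᴿ (+ n / 2) · α →
  + 4 ℤ.* ℚ.↧ q ℤ.* + b ℤ.≤ (ℚ.↧ q ℤ.- 1ℤ) ℤ.* + n
small-books {α} {q@record{}} {b} {n} α<q q<½ (v , b<v , v<nα/2) = bound
  (ℚᵘ.<-respˡ-≃ (toℚᵘ-/ (+ b) 0) (ℚᵘ.<-respʳ-≃ (toℚᵘ-/-* (+ n) 1 q)
    (ℚ.toℚᵘ-mono-< (ℚ.<-trans b<v
      (·-Lower-bound (+ n / 2) {{ℚ.normalize-nonNeg n 2}} α v<nα/2
        (λ Lc → ℝ.lower<upper α Lc α<q))))))
  where
  bound : mkℚᵘ (+ b) 0 ℚᵘ.< mkℚᵘ (+ n) 1 ℚᵘ.* ℚ.toℚᵘ q →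
          + 4 ℤ.* ℚ.↧ q ℤ.* + b ℤ.≤ (ℚ.↧ q ℤ.- 1ℤ) ℤ.* + n
  bound (ℚᵘ.*<* h) = cert
    (lit 2 ⊗ gap (subst (λ d → + b ℤ.* d ℤ.≤ + n ℤ.* ℚ.↥ q ℤ.* 1ℤ)
                        (ℤ.pos-* 2 (ℚ.↧ₙ q)) (ℤ.<⇒≤ h))
     ⊕ lit n ⊗ gap (<½⇒2↥<↧ q q<½))
    (eq (+ b) (+ n) (ℚ.↥ q) (ℚ.↧ q))
    where
    eq : ∀ b n p r → + 2 ℤ.* (n ℤ.* p ℤ.* 1ℤ ℤ.- b ℤ.* (+ 2 ℤ.* r))
           ℤ.+ n ℤ.* (r ℤ.- 1ℤ ℤ.- + 2 ℤ.* p) ≡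
         (r ℤ.- 1ℤ) ℤ.* n ℤ.- + 4 ℤ.* r ℤ.* b
    eq = solve-∀

scaled-≤ : ∀ s K t → + s ℤ.≤ + ℕ.suc K ℤ.* + t → + s / 1 ℚ.* (+ 1 / ℕ.suc K) ℚ.≤ + t / 1
scaled-≤ s K t h = ℚ.toℚᵘ-cancel-≤
  (ℚᵘ.≤-respˡ-≃ (ℚᵘ.≃-sym (ℚᵘ.≃-trans (toℚᵘ-/-* (+ s) 0 (+ 1 / ℕ.suc K))
                              (ℚᵘ.*-congˡ {mkℚᵘ (+ s) 0} (toℚᵘ-/ (+ 1) K))))
  (ℚᵘ.≤-respʳ-≃ (ℚᵘ.≃-sym (toℚᵘ-/ (+ t) 0))
    (ℚᵘ.*≤* (subst₂ ℤ._≤_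
      (sym (trans (ℤ.*-identityʳ (+ s ℤ.* 1ℤ)) (ℤ.*-identityʳ (+ s))))
      (trans (ℤ.*-comm (+ ℕ.suc K) (+ t)) (cong (λ d → + t ℤ.* + d) (sym (ℕ.*-identityˡ (ℕ.suc K)))))
      h))))

theorem2 : ∀ (α : ℝ) → fromℚ (+ 1 / 3) <ᴿ α → α <ᴿ fromℚ (+ 1 / 2) →
    ∃[ β ] (0ℝ <ᴿ β × ∃[ N ] (∀ (n : ℕ) → N ≤ n → (G : Graph n) →
    (n ^ 2) ℕ./ 4 + 1 ≤ #edges G →
    fromℕ (b G) <ᴿ (+ n / 2) · α →
    (+ (n ^ 3) / 1) · β ≤ᴿ fromℕ (#triangles G)))
theorem2 α _ (q , α<q , q<½) =
  -- K is the constant 6 `threshold k` of `triangle-count`; its successor makes the denominator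
  -- visibly nonzero and weakens the bound only slightly. `N` is 0 because that count covers every
  -- n.
  fromℚ (+ 1 / ℕ.suc K) , ℚ.<-dense (ℚ.positive⁻¹ (+ 1 / ℕ.suc K) {{ℚ.normalize-pos 1 (ℕ.suc K)}}) ,
  0 , λ n _ G many-edges books v v<n³β → ℚ.<-≤-trans
    (·-Lower-bound (+ (n ^ 3) / 1) {{ℚ.normalize-nonNeg (n ^ 3) 1}} (fromℚ (+ 1 / ℕ.suc K)) v<n³β (λ c<β → c<β))
    (scaled-≤ (n ^ 3) K (#triangles G) (count n G many-edges (small-books {α} {q} {b G} {n} α<q q<½ books)))
  where
  -- The witness q of α < 1/2 lies strictly between the two. Its denominator k gives q ≤ (1 -
  -- 1/k)/2.
  k : ℤ
  k = ℚ.↧ q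
  1≤k : 1ℤ ℤ.≤ k
  1≤k = ℤ.+≤+ (ℕ.s≤s ℕ.z≤n)
  0≤K : 0ℤ ℤ.≤ + 6 ℤ.* threshold k
  0≤K = lit 6 ⊗ 0≤threshold k (1≤⇒0≤ 1≤k)
  K : ℕ
  K = ℤ.∣ + 6 ℤ.* threshold k ∣
  count : ∀ n (G : Graph n) → (n ^ 2) ℕ./ 4 + 1 ≤ #edges G →
          + 4 ℤ.* k ℤ.* + b G ℤ.≤ (k ℤ.- 1ℤ) ℤ.* + n →
          + (n ^ 3) ℤ.≤ + ℕ.suc K ℤ.* + #triangles G
  count n G many-edges books = begin
    + (n ^ 3)                                             ≡⟨ cube ⟩
    + n ℤ.* + n ℤ.* + n                                   ≤⟨ triangle-count k 1≤k G many-edges books ⟩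
    + 6 ℤ.* threshold k ℤ.* + #triangles G     ≡⟨ cong (ℤ._* + #triangles G) (ℤ.0≤i⇒+∣i∣≡i 0≤K) ⟨
    + K ℤ.* + #triangles G                                ≤⟨ ℤ.*-monoʳ-≤-nonNeg (+ #triangles G) (ℤ.+≤+ (ℕ.n≤1+n K)) ⟩
    + ℕ.suc K ℤ.* + #triangles G                          ∎
    where
    open ℤ.≤-Reasoning
    cube : + (n ^ 3) ≡ + n ℤ.* + n ℤ.* + n
    cube = trans (ℤ.pos-* n (n ^ 2)) (trans (cong (+ n ℤ.*_)
             (trans (ℤ.pos-* n (n ^ 1)) (cong (+ n ℤ.*_)
               (trans (ℤ.pos-* n 1) (ℤ.*-identityʳ (+ n))))))
             (sym (ℤ.*-assoc (+ n) (+ n) (+ n))))
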